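{- Let $m\ge 1$ and $N\ge 0$ be integers, and let $$\Delta_N=\det\bigl(\gamma^{(2m)}_{i+j-m}(t)\bigr)_{i,j=0}^{N-1}.$$ Then \begin{itemize} \item if $N=0$, then $\Delta_N=1$; \item if $N=mn$ for an integer $n\ge 1$, then $\Delta_N=-\xi\, t^{m(n-1)(mn-2)/2}\,[n-1]_{t^m}$; \item if $N=mn+1$ for an integer $n\ge 0$, then $\Delta_N=(-1)^m\xi\, t^{m^2n(n-1)/2}\,[n]_{t^m}$; \item in all other cases $\Delta_N=0$. \end{itemize} Here $\xi=(-1)^{nm(m-1)/2}$, with $n$ the integer from the respective case.
   Context: Let $t$ be an indeterminate. The Narayana polynomials are $\gamma_0(t)=1$ and, for $n\ge1$, $\gamma_n(t)=\sum_{k=0}^{n-1}\binom{n}{k}\binom{n-1}{k}\frac{1}{k+1}t^k$. Their generating function $\gamma(t,q)=\sum_{n\ge0}\gamma_n(t)q^n$ satisfies $-1+(1-q+tq)\gamma(t,q)-tq\,\gamma(t,q)^2=0$. For an integer $m\ge1$, the polynomials $\gamma^{(2m)}_n(t)$, $n\ge0$, are defined by $\sum_{n\ge0}\gamma^{(2m)}_n(t)q^n=\bigl((\gamma(t,q)-1)/q\bigr)^m$, and one sets $\gamma^{(2m)}_i(t)=0$ for $i<0$. For an integer $n\ge0$ and an indeterminate $x$, $[n]_x=1+x+\cdots+x^{n-1}$, so that $[0]_x=0$. The determinant of a $0\times 0$ matrix is $1$. -}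

module Defs where

open import Data.Nat as ℕ using (ℕ; zero; suc; _∸_; _≡ᵇ_)
import Data.Nat.DivMod as ℕD
open import Data.Nat.Combinatorics using (_C_)
open import Data.Bool using (if_then_else_; true; false)
open import Data.Integer as ℤ using (ℤ; +_)
open import Data.Fin using (Fin; toℕ; punchIn)
import Data.Fin as F
open import Relation.Binary.PropositionalEquality using (_≡_)

sumℤ : ℕ → (ℕ → ℤ) → ℤ
sumℤ zero    f = + 0
sumℤ (suc n) f = sumℤ n f ℤ.+ f n

-- Polynomials in the indeterminate t with integer coefficients,
-- represented by their coefficient sequence (coefficient of t^k).
Poly : Set
Poly = ℕ → ℤ

_≈ₚ_ : Poly → Poly → Set
p ≈ₚ q = ∀ k → p k ≡ q k
infix 4 _≈ₚ_

const : ℤ → Poly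
const c zero    = c
const c (suc _) = + 0

0ₚ 1ₚ : Poly
0ₚ = const (+ 0)
1ₚ = const (+ 1)

tpow : ℕ → Poly
tpow e k = if k ≡ᵇ e then + 1 else + 0

_+ₚ_ : Poly → Poly → Poly
(p +ₚ q) k = p k ℤ.+ q k

-ₚ_ : Poly → Poly
(-ₚ p) k = ℤ.- (p k)

_*ₚ_ : Poly → Poly → Poly
(p *ₚ q) k = sumℤ (suc k) (λ i → p i ℤ.* q (k ∸ i))

infixl 6 _+ₚ_
infixl 7 _*ₚ_

sumₚ : ℕ → (ℕ → Poly) → Poly
sumₚ n f k = sumℤ n (λ i → f i k)

sign : ℕ → ℤ
sign zero    = + 1
sign (suc e) = ℤ.- sign e

qint : ℕ → ℕ → Poly
qint n m = sumₚ n (λ j → tpow (m ℕ.* j))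

-- Narayana polynomials γ_n(t); the coefficient binom(n,k) binom(n-1,k)/(k+1)
-- is an integer (a Narayana number), computed by exact natural division.
narayana : ℕ → Poly
narayana zero    = 1ₚ
narayana (suc n) = sumₚ (suc n) (λ k → const (+ ((((suc n) C k) ℕ.* (n C k)) ℕD./ suc k)) *ₚ tpow k)

-- γ^{(2m)}_n(t): coefficient of q^n in ((γ(t,q) - 1)/q)^m.
-- (γ(t,q)-1)/q = Σ_n γ_{n+1}(t) q^n, and the m-th power is computed by
-- repeated Cauchy products in q.
gammaPow : ℕ → ℕ → Poly
gammaPow zero    zero    = 1ₚ
gammaPow zero    (suc n) = 0ₚ
gammaPow (suc m) n = sumₚ (suc n) (λ k → narayana (suc k) *ₚ gammaPow m (n ∸ k))

-- γ^{(2m)}_{a - m} with the convention γ^{(2m)}_i = 0 for i < 0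
gammaShift : ℕ → ℕ → Poly
gammaShift m a with a ℕ.<ᵇ m
... | true  = 0ₚ
... | false = gammaPow m (a ∸ m)

sumFinₚ : (n : ℕ) → (Fin n → Poly) → Poly
sumFinₚ zero    f = 0ₚ
sumFinₚ (suc n) f = f F.zero +ₚ sumFinₚ n (λ i → f (F.suc i))

det : (n : ℕ) → (Fin n → Fin n → Poly) → Poly
det zero    M = 1ₚ
det (suc n) M = sumFinₚ (suc n) λ j →
  const (sign (toℕ j)) *ₚ M F.zero j *ₚ det n (λ r c → M (F.suc r) (punchIn j c))

Delta : ℕ → ℕ → Poly
Delta m N = det N (λ i j → gammaShift m (toℕ i ℕ.+ toℕ j))

xi : ℕ → ℕ → ℤ
xi m n = sign ((n ℕ.* m ℕ.* (m ∸ 1)) ℕD./ 2)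

{-# OPTIONS --safe #-}
module Submission where

-- Put g = γ(t,q) - 1, so that g = q (1 + g)(1 + t g), and let A m k be the coefficient of q^k in g^m. Then
-- A (m+1) (k+1) = A m k + (1+t) A (m+1) k + t A (m+2) k, and the matrix is (A m (i+j)), i.e. its i-th row lists
-- the coefficients of z^i g^m, where z = 1/q = 1/g + (1+t) + t g. Unitriangular row operations replace z^i by any
-- monic polynomial of degree i in z. The Chebyshev choice g^-i + t^i g^i gives rows B i that are combinations of
-- at most three of the rows A l, and these form a unitriangular matrix. Folding the index at multiples of m gives
-- rows Y in which, up to multiples of A 0 = (1, 0, 0, ...), the indices a m, ..., a m + m - 1 have leading
-- entry t^(a m) in the columns (a+1) m, ..., a m + 1 respectively. If N = n m + 1 or N = (n+1) m, the row of
-- index n m is therefore ± [n]_{t^m} A 0 and what remains is antitriangular in blocks; if N lies strictly between,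
-- the rows of indices n m and n m + 1 are both multiples of A 0.

open import Defs
open import Level using (0ℓ)
open import Algebra.Bundles using (CommutativeRing)
open import Algebra.Solver.Ring.AlmostCommutativeRing using (fromCommutativeRing; _-Raw-AlmostCommutative⟶_)
import Algebra.Properties.Ring
import Algebra.Properties.Semiring.Exp
import Algebra.Solver.Ring
open import Data.Bool as Bool using (true; false)
open import Data.Empty using (⊥-elim)
open import Data.Fin as F using (Fin; toℕ; punchIn)
open import Data.Integer as ℤ using (ℤ; +_)
import Data.Integer.Properties as ℤP
import Data.Integer.Tactic.RingSolver as ℤS
open import Data.Maybe.Base using (Maybe; just; nothing)
open import Data.Nat as ℕ using (ℕ; zero; suc; z≤n; s≤s; _≤_; _<_; _∸_; _≥_)
open import Data.Nat.Combinatorics using (_C_; nCk+nC[k+1]≡[n+1]C[k+1]; nC1≡n; k>n⇒nCk≡0)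
import Data.Nat.Divisibility as ℕDiv
import Data.Nat.DivMod as ℕD
import Data.Nat.Properties as ℕP
open import Data.Nat.Tactic.RingSolver using (solve-∀)
open import Data.Product using (Σ; _×_; _,_)
open import Data.Unit using (tt)
import Relation.Binary.Reasoning.Setoid
open import Relation.Binary.PropositionalEquality as ≡ using (_≡_; _≢_)
open import Relation.Nullary using (yes; no)

import Algebra.Properties.Ring ℤP.+-*-ring as ℤRing

-- The matrix shows only the coefficients of q^j with j >= 0. For row index i > m the Chebyshev
-- combination contains the negative power g^(m-i), whose visible part must be expressed by the rows
-- `A l`. Since g^-n + t^n g^n is a polynomial in z = 1/q, its visible part is its constant term; at
-- z = 0 one has g = -1 or g = -1/t, and both give (-1)^n (1 + t^n). So g^-n is seen as (-1)^n (1 +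
-- t^n) `A 0` minus t^n `A n`. The summand with `A n` starts too far left, and folding exists to
-- cancel it; the multiples of `A 0` accumulate during the folding, and this is where the factor [n]
-- in t^m comes from. A separate difficulty is the link to the given data: Narayana polynomials are
-- defined by a floor quotient of binomials and not by a functional equation. It is bridged by a
-- division-free closed form of `A 1` as a difference of products of binomials.

skip : ℕ → ℕ → ℕ
skip zero    c       = suc c
skip (suc j) zero    = zero
skip (suc j) (suc c) = suc (skip j c)

skip-< : ∀ {j c} → c < j → skip j c ≡ c
skip-< {suc j} {zero}  _         = ≡.refl
skip-< {suc j} {suc c} (s≤s c<j) = ≡.cong suc (skip-< c<j)

skip-≥ : ∀ {j c} → j ≤ c → skip j c ≡ suc c
skip-≥ {zero}          _         = ≡.refl
skip-≥ {suc j} {suc c} (s≤s j≤c) = ≡.cong suc (skip-≥ j≤c)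

skip-bound : ∀ j {c n} → c < n → skip j c < suc n
skip-bound zero            c<n       = s≤s c<n
skip-bound (suc j) {zero}  c<n       = s≤s z≤n
skip-bound (suc j) {suc c} (s≤s c<n) = s≤s (skip-bound j c<n)

-- The cosimplicial identity: two columns deleted in either order leave the same columns. It
-- identifies the minors paired in `D-two-rows`.
skip-comm : ∀ {j k} c → j ≤ k → skip (suc k) (skip j c) ≡ skip j (skip k c)
skip-comm {zero}          c       _         = ≡.refl
skip-comm {suc j} {suc k} zero    _         = ≡.refl
skip-comm {suc j} {suc k} (suc c) (s≤s j≤k) = ≡.cong suc (skip-comm c j≤k)

-- Interpolates between two matrices, so that `D-unitriangular` can exchange one row at a time.
splice : {X : Set} → ℕ → (ℕ → X) → (ℕ → X) → ℕ → X
splice zero    f g i       = g i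
splice (suc k) f g zero    = f zero
splice (suc k) f g (suc i) = splice k (λ l → f (suc l)) (λ l → g (suc l)) i

splice-< : ∀ {X : Set} k (f g : ℕ → X) {i} → i < k → splice k f g i ≡ f i
splice-< (suc k) f g {zero}  _         = ≡.refl
splice-< (suc k) f g {suc i} (s≤s i<k) = splice-< k _ _ i<k

splice-at : ∀ {X : Set} k (f g : ℕ → X) → splice k f g k ≡ g k
splice-at zero    f g = ≡.refl
splice-at (suc k) f g = splice-at k _ _

splice-skip : ∀ {X : Set} k (f g : ℕ → X) i → splice (suc k) f g (skip k i) ≡ splice k f g (skip k i)
splice-skip zero    f g i       = ≡.refl
splice-skip (suc k) f g zero    = ≡.refl
splice-skip (suc k) f g (suc i) = splice-skip k _ _ i

-- The number n(n-1)/2 of inversions of the order-reversing permutation; the sign ξ and the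
-- exponents of t both come from it.
triangle : ℕ → ℕ
triangle zero    = zero
triangle (suc n) = n ℕ.+ triangle n

ℤ-rawRing = CommutativeRing.rawRing ℤP.+-*-commutativeRing

-- Signs and finite sums in a commutative ring

module RingKit
  (R : CommutativeRing 0ℓ 0ℓ)
  (ι : ℤ-rawRing -Raw-AlmostCommutative⟶ fromCommutativeRing R)
  where

  open CommutativeRing R public hiding (zero)
  open Algebra.Properties.Ring ring public
  open Algebra.Properties.Semiring.Exp semiring public using (_^_; ^-homo-*; ^-assocʳ)
  open Relation.Binary.Reasoning.Setoid setoid public

  private
    module ι = _-Raw-AlmostCommutative⟶_ ι

    -- ι itself need not send 0 and 1 to 0# and 1# definitionally.
    ⟦_⟧ : ℤ → Carrier
    ⟦ + 0 ⟧ = 0#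
    ⟦ + 1 ⟧ = 1#
    ⟦ k ⟧   = ι.⟦ k ⟧

    ⟦⟧≈ι : ∀ k → ⟦ k ⟧ ≈ ι.⟦ k ⟧
    ⟦⟧≈ι (+ 0)           = sym ι.0-homo
    ⟦⟧≈ι (+ 1)           = sym ι.1-homo
    ⟦⟧≈ι (+ suc (suc _)) = refl
    ⟦⟧≈ι (ℤ.-[1+ _ ])    = refl

    coefficients : ℤ-rawRing -Raw-AlmostCommutative⟶ fromCommutativeRing R
    coefficients = record
      { ⟦_⟧    = ⟦_⟧
      ; +-homo = λ a b → trans (⟦⟧≈ι (a ℤ.+ b)) (trans (ι.+-homo a b) (sym (+-cong (⟦⟧≈ι a) (⟦⟧≈ι b))))
      ; *-homo = λ a b → trans (⟦⟧≈ι (a ℤ.* b)) (trans (ι.*-homo a b) (sym (*-cong (⟦⟧≈ι a) (⟦⟧≈ι b))))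
      ; -‿homo = λ a → trans (⟦⟧≈ι (ℤ.- a)) (trans (ι.-‿homo a) (sym (-‿cong (⟦⟧≈ι a))))
      ; 0-homo = refl
      ; 1-homo = refl
      }

    _⟦≟⟧_ : ∀ a b → Maybe (⟦ a ⟧ ≈ ⟦ b ⟧)
    a ⟦≟⟧ b with a ℤ.≟ b
    ... | yes a≡b = just (reflexive (≡.cong ⟦_⟧ a≡b))
    ... | no _    = nothing

  open Algebra.Solver.Ring ℤ-rawRing (fromCommutativeRing R) coefficients _⟦≟⟧_ public
    using (solve; _:=_; _:+_; _:*_; :-_; con)

  sgn : ℕ → Carrier
  sgn zero    = 1#
  sgn (suc k) = - sgn k

  sgn-+ : ∀ j k → sgn (j ℕ.+ k) ≈ sgn j * sgn k
  sgn-+ zero    k = sym (*-identityˡ _)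
  sgn-+ (suc j) k = trans (-‿cong (sgn-+ j k)) (-‿distribˡ-* _ _)

  sgn-square : ∀ k → sgn k * sgn k ≈ 1#
  sgn-square zero    = *-identityˡ 1#
  sgn-square (suc k) = trans (solve 1 (λ x → (:- x) :* (:- x) := x :* x) refl (sgn k)) (sgn-square k)

  sum : ℕ → (ℕ → Carrier) → Carrier
  sum zero    f = 0#
  sum (suc n) f = sum n f + f n

  sum-cong : ∀ n {f g} → (∀ i → i < n → f i ≈ g i) → sum n f ≈ sum n g
  sum-cong zero    f≈g = refl
  sum-cong (suc n) f≈g = +-cong (sum-cong n (λ i i<n → f≈g i (ℕP.m<n⇒m<1+n i<n))) (f≈g n ℕP.≤-refl)

  sum-zero : ∀ n {f} → (∀ i → i < n → f i ≈ 0#) → sum n f ≈ 0#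
  sum-zero zero    f≈0 = refl
  sum-zero (suc n) f≈0 =
    trans (+-cong (sum-zero n (λ i i<n → f≈0 i (ℕP.m<n⇒m<1+n i<n))) (f≈0 n ℕP.≤-refl)) (+-identityˡ 0#)

  sum-+ : ∀ n f g → sum n (λ i → f i + g i) ≈ sum n f + sum n g
  sum-+ zero    f g = sym (+-identityˡ 0#)
  sum-+ (suc n) f g = trans (+-congʳ (sum-+ n f g))
    (solve 4 (λ a b c d → (a :+ b) :+ (c :+ d) := (a :+ c) :+ (b :+ d)) refl _ _ _ _)

  sum-*ˡ : ∀ n c f → sum n (λ i → c * f i) ≈ c * sum n f
  sum-*ˡ zero    c f = sym (zeroʳ c)
  sum-*ˡ (suc n) c f = trans (+-congʳ (sum-*ˡ n c f)) (sym (distribˡ c _ _))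

  sum-first : ∀ n f → sum (suc n) f ≈ f 0 + sum n (λ i → f (suc i))
  sum-first zero    f = +-comm 0# (f 0)
  sum-first (suc n) f = trans (+-congʳ (sum-first n f)) (+-assoc _ _ _)

  sum-truncate : ∀ n d f → (∀ i → n ≤ i → i < n ℕ.+ d → f i ≈ 0#) → sum (n ℕ.+ d) f ≈ sum n f
  sum-truncate n zero    f f≈0 = reflexive (≡.cong (λ k → sum k f) (ℕP.+-identityʳ n))
  sum-truncate n (suc d) f f≈0 = begin
    sum (n ℕ.+ suc d) f
      ≡⟨ ≡.cong (λ k → sum k f) (ℕP.+-suc n d) ⟩
    sum (n ℕ.+ d) f + f (n ℕ.+ d)
      ≈⟨ +-cong (sum-truncate n d f λ i n≤i i< → f≈0 i n≤i (ℕP.<-trans i< (ℕP.+-monoʳ-< n (ℕP.n<1+n d))))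
           (f≈0 (n ℕ.+ d) (ℕP.m≤m+n n d) (ℕP.+-monoʳ-< n (ℕP.n<1+n d))) ⟩
    sum n f + 0#
      ≈⟨ +-identityʳ _ ⟩
    sum n f ∎

  -- Cuts a rectangle of n+1 by n cells along a staircase: cells with j <= k stay in place, and
  -- every other cell has the form (k+1, j) with j <= k.
  sum-staircase : ∀ n (f : ℕ → ℕ → Carrier) →
    sum (suc n) (λ j → sum n (f j)) ≈ sum n (λ k → sum (suc k) (λ j → f j k + f (suc k) j))
  sum-staircase zero    f = +-identityˡ 0#
  sum-staircase (suc n) f = begin
    sum (suc n) (λ j → sum n (f j) + f j n) + sum (suc n) (f (suc n))
      ≈⟨ +-congʳ (sum-+ (suc n) _ _) ⟩
    (sum (suc n) (λ j → sum n (f j)) + sum (suc n) (λ j → f j n)) + sum (suc n) (f (suc n))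
      ≈⟨ +-assoc _ _ _ ⟩
    sum (suc n) (λ j → sum n (f j)) + (sum (suc n) (λ j → f j n) + sum (suc n) (f (suc n)))
      ≈⟨ +-cong (sum-staircase n f) (sym (sum-+ (suc n) _ _)) ⟩
    sum n (λ k → sum (suc k) (λ j → f j k + f (suc k) j)) + sum (suc n) (λ j → f j n + f (suc n) j) ∎

-- Determinants by Laplace expansion

module Determinant
  (R : CommutativeRing 0ℓ 0ℓ)
  (ι : ℤ-rawRing -Raw-AlmostCommutative⟶ fromCommutativeRing R)
  where

  open RingKit R ι

  -- Rows are infinite and `D n` reads only their first `n` entries, so column shifts and index
  -- arithmetic need no bounds in the types.
  Row : Set
  Row = ℕ → Carrier

  infix 4 _≋_
  _≋_ : Row → Row → Set
  r ≋ s = ∀ j → r j ≈ s j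

  minor : ℕ → (ℕ → Row) → ℕ → Row
  minor j ρ i c = ρ (suc i) (skip j c)

  -- Opaque so that the matrix stays recoverable from a goal mentioning its determinant.
  opaque
    D : ℕ → (ℕ → Row) → Carrier
    D zero    ρ = 1#
    D (suc n) ρ = sum (suc n) (λ j → sgn j * ρ 0 j * D n (minor j ρ))

  opaque
    unfolding D

    D-empty : ∀ ρ → D 0 ρ ≈ 1#
    D-empty ρ = refl

    D-expand : ∀ n ρ → D (suc n) ρ ≈ sum (suc n) (λ j → sgn j * ρ 0 j * D n (minor j ρ))
    D-expand n ρ = refl

  infixr 5 _◂_
  _◂_ : Row → (ℕ → Row) → ℕ → Row
  (r ◂ ρ) zero    = r
  (r ◂ ρ) (suc i) = ρ i

  move : ℕ → (ℕ → Row) → ℕ → Row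
  move k ρ = ρ k ◂ (λ i → ρ (skip k i))

  D-cong : ∀ n {ρ σ} → (∀ i c → i < n → c < n → ρ i c ≈ σ i c) → D n ρ ≈ D n σ
  D-cong zero    ρ≈σ = trans (D-empty _) (sym (D-empty _))
  D-cong (suc n) ρ≈σ = trans (D-expand n _) (trans (sum-cong (suc n) λ j j<n →
    *-cong (*-congˡ (ρ≈σ 0 j (s≤s z≤n) j<n))
      (D-cong n λ i c i<n c<n → ρ≈σ (suc i) (skip j c) (s≤s i<n) (skip-bound j c<n)))
    (sym (D-expand n _)))

  D-cong-◂ : ∀ n {r s} {ρ σ} → r ≋ s → (∀ i → ρ i ≋ σ i) → D n (r ◂ ρ) ≈ D n (s ◂ σ)
  D-cong-◂ n r≋s ρ≋σ = D-cong n λ { zero c _ _ → r≋s c ; (suc i) c _ _ → ρ≋σ i c }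

  private
    corner : ℕ → (ℕ → Row) → ℕ → ℕ → Carrier
    corner n ρ j k = D n (λ i c → ρ i (skip j (skip k c)))

  -- Expanding twice meets each pair of columns j < k+1 in both orders. The two terms share a minor
  -- and carry opposite signs, which leaves a 2 by 2 determinant; alternation in the first two rows
  -- can then be read off.
  D-two-rows : ∀ n x y ρ → D (suc (suc n)) (x ◂ y ◂ ρ) ≈
    sum (suc n) (λ k → sum (suc k) (λ j →
      sgn j * sgn k * (x j * y (suc k) + - (x (suc k) * y j)) * corner n ρ j k))
  D-two-rows n x y ρ = begin
    D (suc (suc n)) (x ◂ y ◂ ρ)
      ≈⟨ trans (D-expand (suc n) _) (sum-cong (suc (suc n)) (λ j _ → *-congˡ (D-expand n _))) ⟩
    sum (suc (suc n)) (λ j → sgn j * x j * sum (suc n) (λ k → sgn k * y (skip j k) * corner n ρ j k))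
      ≈⟨ sum-cong (suc (suc n)) (λ j _ → sym (sum-*ˡ (suc n) _ _)) ⟩
    sum (suc (suc n)) (λ j → sum (suc n) (f j))
      ≈⟨ sum-staircase (suc n) f ⟩
    sum (suc n) (λ k → sum (suc k) (λ j → f j k + f (suc k) j))
      ≈⟨ sum-cong (suc n) (λ k _ → sum-cong (suc k) (λ { j (s≤s j≤k) → pair j k j≤k })) ⟩
    sum (suc n) (λ k → sum (suc k) (λ j →
      sgn j * sgn k * (x j * y (suc k) + - (x (suc k) * y j)) * corner n ρ j k)) ∎
    where
    f : ℕ → ℕ → Carrier
    f j k = sgn j * x j * (sgn k * y (skip j k) * corner n ρ j k)
    pair : ∀ j k → j ≤ k → f j k + f (suc k) j ≈
      sgn j * sgn k * (x j * y (suc k) + - (x (suc k) * y j)) * corner n ρ j k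
    pair j k j≤k = begin
      f j k + f (suc k) j
        -- With column j deleted first, column k+1 is found at place k; with column k+1 deleted
        -- first, column j keeps its place.
        ≈⟨ +-cong (*-congˡ (*-congʳ (*-congˡ (reflexive (≡.cong y (skip-≥ j≤k))))))
             (*-congˡ (*-cong (*-congˡ (reflexive (≡.cong y (skip-< (s≤s j≤k)))))
               (D-cong n λ i c _ _ → reflexive (≡.cong (ρ i) (skip-comm c j≤k))))) ⟩
      sgn j * x j * (sgn k * y (suc k) * corner n ρ j k) +
      - sgn k * x (suc k) * (sgn j * y j * corner n ρ j k)
        ≈⟨ solve 7 (λ a b c d e f g →
             a :* c :* (b :* d :* g) :+ (:- b) :* e :* (a :* f :* g) :=
             a :* b :* (c :* d :+ :- (e :* f)) :* g)
             refl (sgn j) (sgn k) (x j) (y (suc k)) (x (suc k)) (y j) (corner n ρ j k) ⟩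
      sgn j * sgn k * (x j * y (suc k) + - (x (suc k) * y j)) * corner n ρ j k ∎

  D-repeated : ∀ n x ρ → D (suc (suc n)) (x ◂ x ◂ ρ) ≈ 0#
  D-repeated n x ρ = trans (D-two-rows n x x ρ)
    (sum-zero (suc n) λ k _ → sum-zero (suc k) λ j _ →
      trans (*-congʳ (trans (*-congˡ (trans (+-congˡ (-‿cong (*-comm _ _))) (-‿inverseʳ _))) (zeroʳ _))) (zeroˡ _))

  D-swap : ∀ n x y ρ → D (suc (suc n)) (x ◂ y ◂ ρ) ≈ - D (suc (suc n)) (y ◂ x ◂ ρ)
  D-swap n x y ρ = begin
    D (suc (suc n)) (x ◂ y ◂ ρ) ≈⟨ D-two-rows n x y ρ ⟩
    sum (suc n) (λ k → sum (suc k) (λ j → term x y j k))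
      ≈⟨ sum-cong (suc n) (λ k _ → trans (sum-cong (suc k) (λ j _ → negated j k)) (sum-*ˡ (suc k) _ _)) ⟩
    sum (suc n) (λ k → - 1# * sum (suc k) (λ j → term y x j k))
      ≈⟨ sum-*ˡ (suc n) _ _ ⟩
    - 1# * sum (suc n) (λ k → sum (suc k) (λ j → term y x j k))
      ≈⟨ -1*x≈-x _ ⟩
    - sum (suc n) (λ k → sum (suc k) (λ j → term y x j k))
      ≈⟨ -‿cong (D-two-rows n y x ρ) ⟨
    - D (suc (suc n)) (y ◂ x ◂ ρ) ∎
    where
    term : Row → Row → ℕ → ℕ → Carrier
    term x y j k = sgn j * sgn k * (x j * y (suc k) + - (x (suc k) * y j)) * corner n ρ j k
    negated : ∀ j k → term x y j k ≈ - 1# * term y x j k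
    negated j k = trans
      (solve 7 (λ a b c d e f g →
        a :* b :* (c :* d :+ :- (e :* f)) :* g := :- (a :* b :* (f :* e :+ :- (d :* c)) :* g))
        refl (sgn j) (sgn k) (x j) (y (suc k)) (x (suc k)) (y j) _)
      (sym (-1*x≈-x _))

  D-linear : ∀ n x c y ρ → D (suc n) ((λ j → x j + c * y j) ◂ ρ) ≈ D (suc n) (x ◂ ρ) + c * D (suc n) (y ◂ ρ)
  D-linear n x c y ρ = begin
    D (suc n) ((λ j → x j + c * y j) ◂ ρ)
      ≈⟨ D-expand n _ ⟩
    sum (suc n) (λ j → sgn j * (x j + c * y j) * D n (minor j (x ◂ ρ)))
      ≈⟨ sum-cong (suc n) (λ j _ → solve 5 (λ s x c y d → s :* (x :+ c :* y) :* d := s :* x :* d :+ c :* (s :* y :* d))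
           refl (sgn j) (x j) c (y j) _) ⟩
    sum (suc n) (λ j → sgn j * x j * D n (minor j (x ◂ ρ)) + c * (sgn j * y j * D n (minor j (x ◂ ρ))))
      ≈⟨ trans (sum-+ (suc n) _ _) (+-cong (sym (D-expand n _)) (trans (sum-*ˡ (suc n) _ _) (*-congˡ (sym (D-expand n _))))) ⟩
    D (suc n) (x ◂ ρ) + c * D (suc n) (y ◂ ρ) ∎

  D-zero-row : ∀ n {x} ρ → (∀ j → j < suc n → x j ≈ 0#) → D (suc n) (x ◂ ρ) ≈ 0#
  D-zero-row n ρ x≈0 = trans (D-expand n _) (sum-zero (suc n) λ j j<n →
    trans (*-congʳ (trans (*-congˡ (x≈0 j j<n)) (zeroʳ _))) (zeroˡ _))

  mutual
    -- Induction through the minors: `D-move-below` brings the row to second place inside every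
    -- minor of the top row, and `D-swap` carries it over the top row for one more sign.
    D-move : ∀ n k ρ → k < n → D n ρ ≈ sgn k * D n (move k ρ)
    D-move n zero ρ _ =
      trans (D-cong n λ { zero c _ _ → refl ; (suc i) c _ _ → refl }) (sym (*-identityˡ _))
    D-move (suc (suc n)) (suc k) ρ (s≤s k<n) = begin
      D (2 ℕ.+ n) ρ
        ≈⟨ D-cong (2 ℕ.+ n) (λ { zero c _ _ → refl ; (suc i) c _ _ → refl }) ⟩
      D (2 ℕ.+ n) (ρ 0 ◂ (λ i → ρ (suc i)))
        ≈⟨ D-move-below (suc n) (ρ 0) k _ k<n ⟩
      sgn k * D (2 ℕ.+ n) (ρ 0 ◂ ρ (suc k) ◂ (λ i → ρ (suc (skip k i))))
        ≈⟨ *-congˡ (D-swap n _ _ _) ⟩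
      sgn k * - D (2 ℕ.+ n) (ρ (suc k) ◂ ρ 0 ◂ (λ i → ρ (suc (skip k i))))
        ≈⟨ solve 2 (λ a b → a :* (:- b) := (:- a) :* b) refl _ _ ⟩
      - sgn k * D (2 ℕ.+ n) (ρ (suc k) ◂ ρ 0 ◂ (λ i → ρ (suc (skip k i))))
        ≈⟨ *-congˡ (D-cong-◂ (2 ℕ.+ n) (λ _ → refl) (λ { zero _ → refl ; (suc i) _ → refl })) ⟩
      - sgn k * D (2 ℕ.+ n) (move (suc k) ρ) ∎

    D-move-below : ∀ n x k τ → k < n → D (suc n) (x ◂ τ) ≈ sgn k * D (suc n) (x ◂ move k τ)
    D-move-below n x k τ k<n = begin
      D (suc n) (x ◂ τ)
        ≈⟨ D-expand n _ ⟩
      sum (suc n) (λ j → sgn j * x j * D n (minor j (x ◂ τ)))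
        ≈⟨ sum-cong (suc n) (λ j _ → trans (*-congˡ (trans (D-move n k (minor j (x ◂ τ)) k<n)
             (*-congˡ (D-cong n λ { zero _ _ _ → refl ; (suc _) _ _ _ → refl }))))
             (solve 3 (λ a b c → a :* (b :* c) := b :* (a :* c)) refl _ _ _)) ⟩
      sum (suc n) (λ j → sgn k * (sgn j * x j * D n (minor j (x ◂ move k τ))))
        ≈⟨ trans (sum-*ˡ (suc n) _ _) (*-congˡ (sym (D-expand n _))) ⟩
      sgn k * D (suc n) (x ◂ move k τ) ∎

  D-duplicate : ∀ n l τ → l < n → D (suc n) (τ l ◂ τ) ≈ 0#
  D-duplicate (suc n) l τ l<n =
    trans (D-move-below (suc n) (τ l) l τ l<n) (trans (*-congˡ (D-repeated n _ _)) (zeroʳ _))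

  -- Each constructor carries its own pointwise equation. A combination can thus be taken apart one
  -- multiple at a time, by linearity in `D-span` and under a column shift in `shift-span`.
  data Span (σ : ℕ → Row) (n : ℕ) : Row → Set where
    span-0 : ∀ {r} → (∀ j → r j ≈ 0#) → Span σ n r
    span-+ : ∀ {r s} l c → l < n → Span σ n r → (∀ j → s j ≈ r j + c * σ l j) → Span σ n s

  D-span : ∀ n k {σ τ s} → k ≤ n → (∀ l → l < k → τ l ≡ σ l) → Span σ k s → D (suc n) (s ◂ τ) ≈ 0#
  D-span n k {τ = τ} k≤n τ≡σ (span-0 s≈0) = D-zero-row n τ (λ j _ → s≈0 j)
  D-span n k {σ} {τ} k≤n τ≡σ (span-+ {r} {s} l c l<k r∈ s≈) = begin
    D (suc n) (s ◂ τ)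
      ≈⟨ D-cong-◂ (suc n) (λ j → trans (s≈ j) (+-congˡ (*-congˡ (reflexive (≡.cong (λ r → r j) (≡.sym (τ≡σ l l<k)))))))
           (λ _ _ → refl) ⟩
    D (suc n) ((λ j → r j + c * τ l j) ◂ τ)
      ≈⟨ D-linear n r c (τ l) τ ⟩
    D (suc n) (r ◂ τ) + c * D (suc n) (τ l ◂ τ)
      ≈⟨ +-cong (D-span n k k≤n τ≡σ r∈) (*-congˡ (D-duplicate n l τ (ℕP.<-≤-trans l<k k≤n))) ⟩
    0# + c * 0#
      ≈⟨ trans (+-identityˡ _) (zeroʳ c) ⟩
    0# ∎

  infix 4 _≡_mod-span_
  _≡_mod-span_ : Row → ℕ → (ℕ → Row) → Set
  r ≡ i mod-span σ = Σ Row λ s → Span σ i s × (∀ j → r j ≈ σ i j + s j)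

  -- Rows are exchanged from the top down: when row `k` is treated, the rows above it are already
  -- those of `σ`, so the error term is a combination of rows present in the matrix and contributes
  -- nothing.
  D-unitriangular : ∀ n ρ σ → (∀ i → i < n → ρ i ≡ i mod-span σ) → D n ρ ≈ D n σ
  D-unitriangular n ρ σ tri = trans (chain n ℕP.≤-refl)
    (D-cong n λ i c i<n _ → reflexive (≡.cong (λ r → r c) (splice-< n σ ρ i<n)))
    where
    step : ∀ n k → k < n → ρ k ≡ k mod-span σ → D n (splice k σ ρ) ≈ D n (splice (suc k) σ ρ)
    step (suc n) k k<n (s , s∈ , ρk≈) = begin
      D (suc n) (splice k σ ρ)
        ≈⟨ D-move (suc n) k _ k<n ⟩
      sgn k * D (suc n) (splice k σ ρ k ◂ τ)
        ≈⟨ *-congˡ (D-cong-◂ (suc n)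
             (λ j → trans (reflexive (≡.cong (λ r → r j) (splice-at k σ ρ)))
                      (trans (ρk≈ j) (+-congˡ (sym (*-identityˡ _))))) (λ _ _ → refl)) ⟩
      sgn k * D (suc n) ((λ j → σ k j + 1# * s j) ◂ τ)
        ≈⟨ *-congˡ (D-linear n (σ k) 1# s τ) ⟩
      sgn k * (D (suc n) (σ k ◂ τ) + 1# * D (suc n) (s ◂ τ))
        ≈⟨ *-congˡ (+-congˡ (*-congˡ (D-span n k (ℕP.≤-pred k<n)
             (λ l l<k → ≡.trans (≡.cong (splice k σ ρ) (skip-< l<k)) (splice-< k σ ρ l<k)) s∈))) ⟩
      sgn k * (D (suc n) (σ k ◂ τ) + 1# * 0#)
        ≈⟨ *-congˡ (trans (+-congˡ (zeroʳ _)) (+-identityʳ _)) ⟩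
      sgn k * D (suc n) (σ k ◂ τ)
        ≈⟨ *-congˡ (D-cong-◂ (suc n)
             (λ j → reflexive (≡.cong (λ r → r j) (≡.sym (splice-< (suc k) σ ρ ℕP.≤-refl))))
             (λ i j → reflexive (≡.cong (λ r → r j) (≡.sym (splice-skip k σ ρ i))))) ⟩
      sgn k * D (suc n) (move k (splice (suc k) σ ρ))
        ≈⟨ D-move (suc n) k _ k<n ⟨
      D (suc n) (splice (suc k) σ ρ) ∎
      where
      τ : ℕ → Row
      τ i = splice k σ ρ (skip k i)
    chain : ∀ k → k ≤ n → D n ρ ≈ D n (splice k σ ρ)
    chain zero    _   = refl
    chain (suc k) k<n = trans (chain k (ℕP.<⇒≤ k<n)) (step n k k<n (tri k k<n))

  -- In the expansion the term of column 0 has a zero entry, and every other minor still contains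
  -- column 0, which allows induction.
  D-zero-column : ∀ n {ρ} → (∀ i → i < suc n → ρ i 0 ≈ 0#) → D (suc n) ρ ≈ 0#
  D-zero-column n {ρ} ρ≈0 = trans (D-expand n _) (trans (sum-first n _) (trans (+-cong
    (trans (*-congʳ (trans (*-congˡ (ρ≈0 0 (s≤s z≤n))) (zeroʳ _))) (zeroˡ _))
    (sum-zero n (rest n ρ≈0))) (+-identityˡ 0#)))
    where
    rest : ∀ n → (∀ i → i < suc n → ρ i 0 ≈ 0#) →
      ∀ j → j < n → sgn (suc j) * ρ 0 (suc j) * D n (minor (suc j) ρ) ≈ 0#
    rest (suc n) ρ≈0 j _ = trans (*-congˡ (D-zero-column n λ i i<n → ρ≈0 (suc i) (s≤s i<n))) (zeroʳ _)

  D-pivot : ∀ n ρ → (∀ i → i < n → ρ (suc i) 0 ≈ 0#) →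
    D (suc n) ρ ≈ ρ 0 0 * D n (λ i c → ρ (suc i) (suc c))
  D-pivot n ρ ρ≈0 = trans (D-expand n _) (trans (sum-first n _) (trans (+-cong (*-congʳ (*-identityˡ _)) (sum-zero n (rest n ρ≈0))) (+-identityʳ _)))
    where
    rest : ∀ n → (∀ i → i < n → ρ (suc i) 0 ≈ 0#) →
      ∀ j → j < n → sgn (suc j) * ρ 0 (suc j) * D n (minor (suc j) ρ) ≈ 0#
    rest (suc n) ρ≈0 j _ = trans (*-congˡ (D-zero-column n ρ≈0)) (zeroʳ _)

  D-first-row : ∀ n x τ → (∀ j → j < n → x (suc j) ≈ 0#) →
    D (suc n) (x ◂ τ) ≈ x 0 * D n (λ i c → τ i (suc c))
  D-first-row n x τ x≈0 = trans (D-expand n _) (trans (sum-first n _) (trans (+-cong (*-congʳ (*-identityˡ _))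
    (sum-zero n λ j j<n → trans (*-congʳ (trans (*-congˡ (x≈0 j j<n)) (zeroʳ _))) (zeroˡ _))) (+-identityʳ _)))

  -- The last row of the block has its leading entry in column 0. Lifting it to the top makes that
  -- entry a pivot and leaves a block smaller by one; the lifting costs add up to `triangle s`.
  D-antitriangular-block : ∀ s n u ρ →
    (∀ b x → suc (b ℕ.+ x) ≡ s → ρ b x ≈ u) →
    (∀ b x c → suc (b ℕ.+ x) ≡ s → c < x → ρ b c ≈ 0#) →
    (∀ i c → i < n → c < s → ρ (s ℕ.+ i) c ≈ 0#) →
    D (s ℕ.+ n) ρ ≈ sgn (triangle s) * (u ^ s * D n (λ i c → ρ (s ℕ.+ i) (s ℕ.+ c)))
  D-antitriangular-block zero    n u ρ lead left below = sym (trans (*-identityˡ _) (*-identityˡ _))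
  D-antitriangular-block (suc s) n u ρ lead left below = begin
    D (suc (s ℕ.+ n)) ρ
      ≈⟨ D-move _ s ρ (s≤s (ℕP.m≤m+n s n)) ⟩
    sgn s * D (suc (s ℕ.+ n)) (move s ρ)
      ≈⟨ *-congˡ (D-pivot (s ℕ.+ n) (move s ρ) column) ⟩
    sgn s * (ρ s 0 * D (s ℕ.+ n) ρ′)
      ≈⟨ *-congˡ (*-cong (lead s 0 (≡.cong suc (ℕP.+-identityʳ s)))
           (D-antitriangular-block s n u ρ′
             (λ b x eq → trans (reflexive (≡.cong (λ i → ρ i (suc x)) (skip-< (before b x eq))))
               (lead b (suc x) (≡.cong suc (≡.trans (ℕP.+-suc b x) eq))))
             (λ b x c eq c<x → trans (reflexive (≡.cong (λ i → ρ i (suc c)) (skip-< (before b x eq))))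
               (left b (suc x) (suc c) (≡.cong suc (≡.trans (ℕP.+-suc b x) eq)) (s≤s c<x)))
             (λ i c i<n c<s → trans (reflexive (≡.cong (λ i → ρ i (suc c)) (skip-≥ (ℕP.m≤m+n s i))))
               (below i (suc c) i<n (s≤s c<s))))) ⟩
    sgn s * (u * (sgn (triangle s) * (u ^ s * D n (λ i c → ρ′ (s ℕ.+ i) (s ℕ.+ c)))))
      ≈⟨ *-congˡ (*-congˡ (*-congˡ (*-congˡ (D-cong n λ i c _ _ →
           reflexive (≡.cong (λ i → ρ i (suc (s ℕ.+ c))) (skip-≥ (ℕP.m≤m+n s i))))))) ⟩
    sgn s * (u * (sgn (triangle s) * (u ^ s * rest)))
      ≈⟨ solve 5 (λ a u b v d → a :* (u :* (b :* (v :* d))) := a :* b :* (u :* v :* d)) refl _ _ _ _ _ ⟩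
    sgn s * sgn (triangle s) * (u * u ^ s * rest)
      ≈⟨ *-congʳ (sgn-+ s (triangle s)) ⟨
    sgn (s ℕ.+ triangle s) * (u * u ^ s * rest) ∎
    where
    ρ′ : ℕ → Row
    ρ′ i c = ρ (skip s i) (suc c)
    rest : Carrier
    rest = D n (λ i c → ρ (suc s ℕ.+ i) (suc s ℕ.+ c))
    before : ∀ b x → suc (b ℕ.+ x) ≡ s → b < s
    before b x eq = ≡.subst (suc b ≤_) eq (s≤s (ℕP.m≤m+n b x))
    column : ∀ i → i < s ℕ.+ n → ρ (skip s i) 0 ≈ 0#
    column i i<s+n with i ℕ.<? s
    ... | yes i<s = trans (reflexive (≡.cong (λ i → ρ i 0) (skip-< i<s)))
          (left i (s ∸ i) 0 (≡.cong suc (ℕP.m+[n∸m]≡n (ℕP.<⇒≤ i<s))) (ℕP.m<n⇒0<n∸m i<s))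
    ... | no i≮s = trans (reflexive (≡.cong (λ i → ρ i 0) (≡.trans (skip-≥ s≤i) (≡.cong suc (≡.sym (ℕP.m+[n∸m]≡n s≤i))))))
          (below (i ∸ s) 0 (ℕP.+-cancelˡ-< s _ _ (≡.subst (_< s ℕ.+ n) (≡.sym (ℕP.m+[n∸m]≡n s≤i)) i<s+n)) (s≤s z≤n))
      where s≤i = ℕP.≮⇒≥ i≮s

  blockProduct : ℕ → (ℕ → Carrier) → ℕ → ℕ → Carrier
  blockProduct m u zero    s = u 0 ^ s
  blockProduct m u (suc n) s = u 0 ^ m * blockProduct m (λ a → u (suc a)) n s

  -- There are `n` full blocks of size `m` and a last one of size `s`, which will be 0 or m - 1. The
  -- last hypothesis is block triangularity, phrased so that it survives the removal of the first
  -- block.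
  D-antitriangular-blocks : ∀ m n s (u : ℕ → Carrier) ρ →
    (∀ a b x → a < n → suc (b ℕ.+ x) ≡ m → ρ (a ℕ.* m ℕ.+ b) (a ℕ.* m ℕ.+ x) ≈ u a) →
    (∀ a b x c → a < n → suc (b ℕ.+ x) ≡ m → c < a ℕ.* m ℕ.+ x → ρ (a ℕ.* m ℕ.+ b) c ≈ 0#) →
    (∀ b x → suc (b ℕ.+ x) ≡ s → ρ (n ℕ.* m ℕ.+ b) (n ℕ.* m ℕ.+ x) ≈ u n) →
    (∀ b x c → suc (b ℕ.+ x) ≡ s → c < n ℕ.* m ℕ.+ x → ρ (n ℕ.* m ℕ.+ b) c ≈ 0#) →
    (∀ a i c → i < n ℕ.* m ℕ.+ s → a ℕ.* m ≤ i → c < a ℕ.* m → ρ i c ≈ 0#) →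
    D (n ℕ.* m ℕ.+ s) ρ ≈ sgn (n ℕ.* triangle m ℕ.+ triangle s) * blockProduct m u n s
  D-antitriangular-blocks m zero s u ρ lead left lead′ left′ below = begin
    D s ρ ≡⟨ ≡.cong (λ k → D k ρ) (≡.sym (ℕP.+-identityʳ s)) ⟩
    D (s ℕ.+ 0) ρ ≈⟨ D-antitriangular-block s 0 (u 0) ρ lead′ left′ (λ i c ()) ⟩
    sgn (triangle s) * (u 0 ^ s * D 0 _) ≈⟨ *-congˡ (trans (*-congˡ (D-empty _)) (*-identityʳ _)) ⟩
    sgn (triangle s) * u 0 ^ s ∎
  D-antitriangular-blocks m (suc n) s u ρ lead left lead′ left′ below = begin
    D (m ℕ.+ n ℕ.* m ℕ.+ s) ρ
      ≡⟨ ≡.cong (λ k → D k ρ) (ℕP.+-assoc m (n ℕ.* m) s) ⟩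
    D (m ℕ.+ (n ℕ.* m ℕ.+ s)) ρ
      ≈⟨ D-antitriangular-block m (n ℕ.* m ℕ.+ s) (u 0) ρ
           (λ b x → lead 0 b x (s≤s z≤n))
           (λ b x c → left 0 b x c (s≤s z≤n))
           (λ i c i< c<m → below 1 (m ℕ.+ i) c
             (≡.subst (m ℕ.+ i <_) (≡.sym (ℕP.+-assoc m (n ℕ.* m) s)) (ℕP.+-monoʳ-< m i<))
             (≡.subst (_≤ m ℕ.+ i) (≡.sym (ℕP.+-identityʳ m)) (ℕP.m≤m+n m i))
             (≡.subst (c <_) (≡.sym (ℕP.+-identityʳ m)) c<m)) ⟩
    sgn (triangle m) * (u 0 ^ m * D (n ℕ.* m ℕ.+ s) ρ′)
      ≈⟨ *-congˡ (*-congˡ (D-antitriangular-blocks m n s (λ a → u (suc a)) ρ′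
           (λ a b x a<n eq → trans (reflexive (≡.cong₂ ρ (shift a b) (shift a x))) (lead (suc a) b x (s≤s a<n) eq))
           (λ a b x c a<n eq c< → trans (reflexive (≡.cong (λ i → ρ i (m ℕ.+ c)) (shift a b)))
             (left (suc a) b x (m ℕ.+ c) (s≤s a<n) eq (raise a x c c<)))
           (λ b x eq → trans (reflexive (≡.cong₂ ρ (shift n b) (shift n x))) (lead′ b x eq))
           (λ b x c eq c< → trans (reflexive (≡.cong (λ i → ρ i (m ℕ.+ c)) (shift n b)))
             (left′ b x (m ℕ.+ c) eq (raise n x c c<)))
           (λ a i c i< am≤i c<am → below (suc a) (m ℕ.+ i) (m ℕ.+ c)
             (≡.subst (m ℕ.+ i <_) (≡.sym (ℕP.+-assoc m (n ℕ.* m) s)) (ℕP.+-monoʳ-< m i<))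
             (ℕP.+-monoʳ-≤ m am≤i) (ℕP.+-monoʳ-< m c<am)))) ⟩
    sgn (triangle m) * (u 0 ^ m * (sgn (n ℕ.* triangle m ℕ.+ triangle s) * blockProduct m (λ a → u (suc a)) n s))
      ≈⟨ solve 4 (λ a b c d → a :* (b :* (c :* d)) := a :* c :* (b :* d)) refl _ _ _ _ ⟩
    sgn (triangle m) * sgn (n ℕ.* triangle m ℕ.+ triangle s) * blockProduct m u (suc n) s
      ≈⟨ *-congʳ (trans (reflexive (≡.cong sgn (ℕP.+-assoc (triangle m) (n ℕ.* triangle m) (triangle s)))) (sgn-+ (triangle m) (n ℕ.* triangle m ℕ.+ triangle s))) ⟨
    sgn (suc n ℕ.* triangle m ℕ.+ triangle s) * blockProduct m u (suc n) s ∎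
    where
    ρ′ : ℕ → Row
    ρ′ i c = ρ (m ℕ.+ i) (m ℕ.+ c)
    shift : ∀ a b → m ℕ.+ (a ℕ.* m ℕ.+ b) ≡ suc a ℕ.* m ℕ.+ b
    shift a b = ≡.sym (ℕP.+-assoc m (a ℕ.* m) b)
    raise : ∀ a x c → c < a ℕ.* m ℕ.+ x → m ℕ.+ c < suc a ℕ.* m ℕ.+ x
    raise a x c c< = ≡.subst (m ℕ.+ c <_) (shift a x) (ℕP.+-monoʳ-< m c<)

-- Index identities for the reflection at multiples of m

private
  2+a-lower : ∀ a b x {m} → b ℕ.+ x ≡ m → suc (suc a) ℕ.* m ≡ b ℕ.+ (suc a ℕ.* m ℕ.+ x)
  2+a-lower a b x ≡.refl = lemma a b x
    where
    lemma : ∀ a b x → suc (suc a) ℕ.* (b ℕ.+ x) ≡ b ℕ.+ (suc a ℕ.* (b ℕ.+ x) ℕ.+ x)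
    lemma = solve-∀

  1+a-lower : ∀ a b x {m} → b ℕ.+ x ≡ m → suc a ℕ.* m ≡ x ℕ.+ (a ℕ.* m ℕ.+ b)
  1+a-lower a b x ≡.refl = lemma a b x
    where
    lemma : ∀ a b x → suc a ℕ.* (b ℕ.+ x) ≡ x ℕ.+ (a ℕ.* (b ℕ.+ x) ℕ.+ b)
    lemma = solve-∀

  1+a-upper : ∀ a {b x m} → b ℕ.+ x ≡ m → suc a ℕ.* m ℕ.+ x ≡ a ℕ.* m ℕ.+ b ℕ.+ (x ℕ.+ x)
  1+a-upper a {b} {x} ≡.refl = lemma a b x
    where
    lemma : ∀ a b x → suc a ℕ.* (b ℕ.+ x) ℕ.+ x ≡ a ℕ.* (b ℕ.+ x) ℕ.+ b ℕ.+ (x ℕ.+ x)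
    lemma = solve-∀

  2+a-upper : ∀ a b m → suc (suc a) ℕ.* m ℕ.+ b ≡ a ℕ.* m ℕ.+ b ℕ.+ (m ℕ.+ m)
  2+a-upper = solve-∀

-- Coefficients of the powers of g, continued to negative exponents

module Walks
  (R : CommutativeRing 0ℓ 0ℓ)
  (ι : ℤ-rawRing -Raw-AlmostCommutative⟶ fromCommutativeRing R)
  (t : CommutativeRing.Carrier R)
  where

  open RingKit R ι
  open Determinant R ι

  -- The recurrence serves as the definition, without any power series in q; `A-convolution`
  -- recovers the fact that these are the powers of a single series.
  A : ℕ → Row
  A zero    zero    = 1#
  A zero    (suc k) = 0#
  A (suc m) zero    = 0#
  A (suc m) (suc k) = A m k + (1# + t) * A (suc m) k + t * A (suc (suc m)) k

  A-below : ∀ {m k} → k < m → A m k ≈ 0#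
  A-below {suc m} {zero}  _         = refl
  A-below {suc m} {suc k} (s≤s k<m) =
    trans (+-cong (+-cong (A-below k<m) (trans (*-congˡ (A-below (ℕP.m<n⇒m<1+n k<m))) (zeroʳ _)))
                  (trans (*-congˡ (A-below (ℕP.m<n⇒m<1+n (ℕP.m<n⇒m<1+n k<m)))) (zeroʳ _)))
          (trans (+-identityʳ _) (+-identityʳ _))

  A-diagonal : ∀ m → A m m ≈ 1#
  A-diagonal zero    = refl
  A-diagonal (suc m) =
    trans (+-cong (+-cong (A-diagonal m) (trans (*-congˡ (A-below {suc m} {m} ℕP.≤-refl)) (zeroʳ _)))
                  (trans (*-congˡ (A-below {suc (suc m)} {m} (ℕP.m<n⇒m<1+n ℕP.≤-refl))) (zeroʳ _)))
          (trans (+-identityʳ _) (+-identityʳ _))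

  -- In series, g times g^m. The recurrence is applied to the second factor only, so induction on
  -- the column `k` suffices, with `A 0` as the unit of the convolution.
  A-convolution : ∀ k m → sum (suc k) (λ i → A 1 i * A m (k ∸ i)) ≈ A (suc m) k
  A-convolution zero    m       = trans (+-identityˡ _) (zeroˡ _)
  A-convolution (suc k) zero    = trans (+-cong
    (sum-zero (suc k) λ { i (s≤s i≤k) → trans (*-congˡ (reflexive (≡.cong (A 0) (ℕP.+-∸-assoc 1 i≤k)))) (zeroʳ _) })
    (trans (*-congˡ (reflexive (≡.cong (A 0) (ℕP.n∸n≡0 k)))) (*-identityʳ _))) (+-identityˡ _)
  A-convolution (suc k) (suc m) = begin
    sum (suc k) (λ i → A 1 i * A (suc m) (suc k ∸ i)) + A 1 (suc k) * A (suc m) (k ∸ k)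
      ≈⟨ +-cong
           (sum-cong (suc k) λ { i (s≤s i≤k) → trans (*-congˡ (reflexive (≡.cong (A (suc m)) (ℕP.+-∸-assoc 1 i≤k))))
             (solve 5 (λ x a b c t → x :* (a :+ (con (+ 1) :+ t) :* b :+ t :* c) :=
               x :* a :+ (con (+ 1) :+ t) :* (x :* b) :+ t :* (x :* c)) refl (A 1 i) _ _ _ t) })
           (trans (*-congˡ (reflexive (≡.cong (A (suc m)) (ℕP.n∸n≡0 k)))) (zeroʳ _)) ⟩
    sum (suc k) (λ i → A 1 i * A m (k ∸ i) + (1# + t) * (A 1 i * A (suc m) (k ∸ i)) + t * (A 1 i * A (suc (suc m)) (k ∸ i))) + 0#
      ≈⟨ trans (+-identityʳ _) (trans (sum-+ (suc k) _ _) (+-congʳ (sum-+ (suc k) _ _))) ⟩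
    sum (suc k) (λ i → A 1 i * A m (k ∸ i)) + sum (suc k) (λ i → (1# + t) * (A 1 i * A (suc m) (k ∸ i))) +
    sum (suc k) (λ i → t * (A 1 i * A (suc (suc m)) (k ∸ i)))
      ≈⟨ +-cong (+-cong (A-convolution k m) (trans (sum-*ˡ (suc k) _ _) (*-congˡ (A-convolution k (suc m)))))
           (trans (sum-*ˡ (suc k) _ _) (*-congˡ (A-convolution k (suc (suc m))))) ⟩
    A (suc (suc m)) (suc k) ∎

  -- This is the Cauchy product in `gammaPow`, offset because each factor g is divided by q there.
  -- The full convolution has `m` further terms, which involve entries of `A m` left of its
  -- diagonal.
  A-convolution-shifted : ∀ m n → sum (suc n) (λ k → A 1 (suc k) * A m (n ∸ k ℕ.+ m)) ≈ A (suc m) (n ℕ.+ suc m)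
  A-convolution-shifted m n = begin
    sum (suc n) (λ k → A 1 (suc k) * A m (n ∸ k ℕ.+ m))
      ≈⟨ sum-cong (suc n) (λ { k (s≤s k≤n) → *-congˡ (reflexive (≡.cong (A m) (≡.sym (ℕP.+-∸-comm m k≤n)))) }) ⟩
    sum (suc n) f
      ≈⟨ sum-truncate (suc n) m f (λ { k (s≤s n<k) k< → trans (*-congˡ (A-below (below n<k k<))) (zeroʳ _) }) ⟨
    sum (suc n ℕ.+ m) f
      ≈⟨ trans (sum-first (suc n ℕ.+ m) _) (trans (+-congʳ (zeroˡ _)) (+-identityˡ _)) ⟨
    sum (suc (suc n ℕ.+ m)) (λ i → A 1 i * A m (suc n ℕ.+ m ∸ i))
      ≈⟨ A-convolution (suc n ℕ.+ m) m ⟩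
    A (suc m) (suc n ℕ.+ m)
      ≡⟨ ≡.cong (A (suc m)) (≡.sym (ℕP.+-suc n m)) ⟩
    A (suc m) (n ℕ.+ suc m) ∎
    where
    f : ℕ → Carrier
    f k = A 1 (suc k) * A m (n ℕ.+ m ∸ k)
    below : ∀ {k} → n ≤ k → suc k < suc n ℕ.+ m → n ℕ.+ m ∸ suc k < m
    below {k} n≤k (s≤s k<) = ℕP.+-cancelʳ-< (suc k) _ _ (≡.subst (_< m ℕ.+ suc k) (≡.sym (ℕP.m∸n+n≡m k<))
      (≡.subst (_< m ℕ.+ suc k) (ℕP.+-comm m n) (ℕP.+-monoʳ-< m (s≤s n≤k))))

  -- The continuation of A to the index -n that keeps the three-term recurrence.
  A⁻ : ℕ → Row
  A⁻ n j = sgn n * (1# + t ^ n) * A 0 j + - (t ^ n * A n j)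

  -- A at the integer index p - n.
  A± : ℕ → ℕ → Row
  A± p       zero    = A p
  A± zero    (suc n) = A⁻ (suc n)
  A± (suc p) (suc n) = A± p n

  -- Indices 0 and -1 are separate cases because their neighbourhoods mix `A` and `A⁻`. At 0 the
  -- left side vanishes, which forces the value of `A⁻ 1`; below -1 the coefficients
  -- `sgn n * (1# + t ^ n)` solve the recurrence by themselves.
  A±-rec : ∀ p n j → A± p n (suc j) ≈ A± p (suc n) j + (1# + t) * A± p n j + t * A± (suc p) n j
  A±-rec zero zero j = solve 3 (λ t a b →
      con (+ 0) := :- con (+ 1) :* (con (+ 1) :+ t :* con (+ 1)) :* a :+ :- (t :* con (+ 1) :* b) :+ (con (+ 1) :+ t) :* a :+ t :* b)
    refl t (A 0 j) (A 1 j)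
  A±-rec (suc p) zero    j = refl
  A±-rec zero (suc zero) j = solve 4 (λ t a b c →
      :- con (+ 1) :* (con (+ 1) :+ t :* con (+ 1)) :* con (+ 0) :+ :- (t :* con (+ 1) :* (a :+ (con (+ 1) :+ t) :* b :+ t :* c)) :=
      (:- (:- con (+ 1))) :* (con (+ 1) :+ t :* (t :* con (+ 1))) :* a :+ :- (t :* (t :* con (+ 1)) :* c) :+
      (con (+ 1) :+ t) :* (:- con (+ 1) :* (con (+ 1) :+ t :* con (+ 1)) :* a :+ :- (t :* con (+ 1) :* b)) :+ t :* a)
    refl t (A 0 j) (A 1 j) (A 2 j)
  A±-rec zero (suc (suc n)) j = solve 7 (λ t s p a b c d →
      (:- (:- s)) :* (con (+ 1) :+ t :* (t :* p)) :* con (+ 0) :+ :- (t :* (t :* p) :* (b :+ (con (+ 1) :+ t) :* c :+ t :* d)) :=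
      (:- (:- (:- s))) :* (con (+ 1) :+ t :* (t :* (t :* p))) :* a :+ :- (t :* (t :* (t :* p)) :* d) :+
      (con (+ 1) :+ t) :* ((:- (:- s)) :* (con (+ 1) :+ t :* (t :* p)) :* a :+ :- (t :* (t :* p) :* c)) :+
      t :* ((:- s) :* (con (+ 1) :+ t :* p) :* a :+ :- (t :* p :* b)))
    refl t (sgn n) (t ^ n) (A 0 j) (A (1 ℕ.+ n) j) (A (2 ℕ.+ n) j) (A (3 ℕ.+ n) j)
  A±-rec (suc p) (suc n) j = A±-rec p n j

  A±-above : ∀ p d → A± (p ℕ.+ d) p ≋ A d
  A±-above zero    d j = refl
  A±-above (suc p) d j = A±-above p d j

  A±-below : ∀ p d → A± p (p ℕ.+ d) ≋ A⁻ d
  -- At offset 0 the formula of `A⁻` gives twice `A 0` minus `A 0`.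
  A±-below zero    zero    j = solve 1 (λ a → a := con (+ 1) :* (con (+ 1) :+ con (+ 1)) :* a :+ :- (con (+ 1) :* a)) refl (A 0 j)
  A±-below zero    (suc d) j = refl
  A±-below (suc p) d       j = A±-below p d j

  sgn-shift : ∀ k x → sgn (k ℕ.+ (x ℕ.+ x)) ≈ sgn k
  sgn-shift k x = trans (sgn-+ k (x ℕ.+ x)) (trans (*-congˡ (trans (sgn-+ x x) (sgn-square x))) (*-identityʳ _))

  -- Row reduction by Chebyshev polynomials and folding

  module Reduction (m : ℕ) .{{_ : ℕ.NonZero m}} where

    H : ℕ → Row
    H i j = A m (i ℕ.+ j)

    -- Row 0 is halved: g^-k + t^k g^k equals 2 at k = 0, and the polynomial in z has to be monic
    -- there as well.
    B : ℕ → Row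
    B zero    j = A m j
    B (suc k) j = A± m (suc k) j + t ^ suc k * A (m ℕ.+ suc k) j

    private
      -- The value 2t at 0 compensates for the halved row `B 0`.
      κ : ℕ → Carrier
      κ zero    = t + t
      κ (suc k) = t

    B-rec₀ : ∀ j → B 0 (suc j) ≈ B 1 j + (1# + t) * B 0 j
    B-rec₀ j = begin
      A m (suc j)
        ≈⟨ A±-rec m 0 j ⟩
      A± m 1 j + (1# + t) * A m j + t * A (suc m) j
        ≡⟨ ≡.cong (λ k → A± m 1 j + (1# + t) * A m j + t * A k j) (ℕP.+-comm 1 m) ⟩
      A± m 1 j + (1# + t) * A m j + t * A (m ℕ.+ 1) j
        ≈⟨ solve 4 (λ t a b c → a :+ (con (+ 1) :+ t) :* b :+ t :* c := (a :+ (t :* con (+ 1)) :* c) :+ (con (+ 1) :+ t) :* b) refl _ _ _ _ ⟩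
      B 1 j + (1# + t) * B 0 j ∎

    private
      A-rec′ : ∀ k j → A (m ℕ.+ suc k) (suc j) ≈ A (m ℕ.+ k) j + (1# + t) * A (m ℕ.+ suc k) j + t * A (m ℕ.+ suc (suc k)) j
      A-rec′ k j = begin
        A (m ℕ.+ suc k) (suc j)
          ≡⟨ ≡.cong (λ l → A l (suc j)) (ℕP.+-suc m k) ⟩
        A (m ℕ.+ k) j + (1# + t) * A (suc (m ℕ.+ k)) j + t * A (suc (suc (m ℕ.+ k))) j
          ≡⟨ ≡.cong₂ (λ l l′ → A (m ℕ.+ k) j + (1# + t) * A l j + t * A l′ j) (≡.sym (ℕP.+-suc m k))
               (≡.sym (≡.trans (ℕP.+-suc m (suc k)) (≡.cong suc (ℕP.+-suc m k)))) ⟩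
        A (m ℕ.+ k) j + (1# + t) * A (m ℕ.+ suc k) j + t * A (m ℕ.+ suc (suc k)) j ∎

      κ-B : ∀ k j → t * A± m k j + t * t ^ k * A (m ℕ.+ k) j ≈ κ k * B k j
      κ-B zero j = begin
        t * A m j + t * 1# * A (m ℕ.+ 0) j
          ≡⟨ ≡.cong (λ k → t * A m j + t * 1# * A k j) (ℕP.+-identityʳ m) ⟩
        t * A m j + t * 1# * A m j
          ≈⟨ solve 2 (λ t a → t :* a :+ t :* con (+ 1) :* a := (t :+ t) :* a) refl t (A m j) ⟩
        (t + t) * A m j ∎
      κ-B (suc k) j = solve 4 (λ t a p b → t :* a :+ t :* p :* b := t :* (a :+ p :* b)) refl t _ (t ^ suc k) _

    -- A column shift is multiplication by z = g^-1 + (1 + t) + t g, which takes g^-k + t^k g^k to a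
    -- combination of itself and its two neighbours.
    B-rec : ∀ k j → B (suc k) (suc j) ≈ B (suc (suc k)) j + (1# + t) * B (suc k) j + κ k * B k j
    B-rec k j = begin
      A± m (suc k) (suc j) + t ^ suc k * A (m ℕ.+ suc k) (suc j)
        ≈⟨ +-cong (A±-rec m (suc k) j) (*-congˡ (A-rec′ k j)) ⟩
      (A± m (2 ℕ.+ k) j + (1# + t) * A± m (suc k) j + t * A± m k j) +
      t ^ suc k * (A (m ℕ.+ k) j + (1# + t) * A (m ℕ.+ suc k) j + t * A (m ℕ.+ suc (suc k)) j)
        ≈⟨ solve 8 (λ t a b c p d e f →
             (a :+ (con (+ 1) :+ t) :* b :+ t :* c) :+ t :* p :* (d :+ (con (+ 1) :+ t) :* e :+ t :* f) :=
             (a :+ t :* (t :* p) :* f) :+ (con (+ 1) :+ t) :* (b :+ t :* p :* e) :+ (t :* c :+ t :* p :* d))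
             refl t _ _ _ (t ^ k) _ _ _ ⟩
      B (2 ℕ.+ k) j + (1# + t) * B (suc k) j + (t * A± m k j + t * t ^ k * A (m ℕ.+ k) j)
        ≈⟨ +-congˡ (κ-B k j) ⟩
      B (2 ℕ.+ k) j + (1# + t) * B (suc k) j + κ k * B k j ∎

    private
      shift-span : ∀ {n r} → Span B n r → Span B (suc n) (λ j → r (suc j))
      shift-span (span-0 r≈0) = span-0 (λ j → r≈0 (suc j))
      shift-span (span-+ {r} zero c l<n r∈ s≈) =
        span-+ 0 (c * (1# + t)) (ℕP.m<n⇒m<1+n l<n)
          (span-+ 1 c (s≤s l<n) (shift-span r∈) (λ _ → refl))
          (λ j → trans (s≈ (suc j)) (trans (+-congˡ (*-congˡ (B-rec₀ j)))
            (solve 5 (λ r c a u b → r :+ c :* (a :+ u :* b) := r :+ c :* a :+ c :* u :* b) refl _ _ _ _ _)))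
      shift-span (span-+ {r} (suc l) c l<n r∈ s≈) =
        span-+ l (c * κ l) (ℕP.<-trans (ℕP.n<1+n l) (ℕP.m<n⇒m<1+n l<n))
          (span-+ (suc l) (c * (1# + t)) (ℕP.m<n⇒m<1+n l<n)
            (span-+ (suc (suc l)) c (s≤s l<n) (shift-span r∈) (λ _ → refl)) (λ _ → refl))
          (λ j → trans (s≈ (suc j)) (trans (+-congˡ (*-congˡ (B-rec l j)))
            (solve 7 (λ r c a u b k d → r :+ c :* (a :+ u :* b :+ k :* d) := r :+ c :* a :+ c :* u :* b :+ c :* k :* d) refl _ _ _ _ _ _ _)))

      shift-B : ∀ i {s} → Span B (suc i) s →
        Σ Row λ s′ → Span B (suc i) s′ × (∀ j → B i (suc j) + s j ≈ B (suc i) j + s′ j)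
      shift-B zero {s} s∈ =
        _ , span-+ 0 (1# + t) (s≤s z≤n) s∈ (λ _ → refl) ,
        λ j → trans (+-congʳ (B-rec₀ j)) (solve 3 (λ a b s → a :+ b :+ s := a :+ (s :+ b)) refl _ _ _)
      shift-B (suc i) {s} s∈ =
        _ , span-+ i (κ i) (ℕP.m<n⇒m<1+n (ℕP.n<1+n i)) (span-+ (suc i) (1# + t) (ℕP.n<1+n _) s∈ (λ _ → refl)) (λ _ → refl) ,
        λ j → trans (+-congʳ (B-rec i j)) (solve 4 (λ a b c s → a :+ b :+ c :+ s := a :+ (s :+ b :+ c)) refl _ _ _ _)

    -- `H (suc i)` is `H i` shifted by one column, and the shift takes a monic combination of degree
    -- i to a monic one of degree i + 1.
    H-mod-B : ∀ i → H i ≡ i mod-span B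
    H-mod-B zero    = (λ _ → 0#) , span-0 (λ _ → refl) , λ j → sym (+-identityʳ _)
    H-mod-B (suc i) with H-mod-B i
    ... | s , s∈ , H≈ with shift-B i (shift-span s∈)
    ... | s′ , s′∈ , eq = s′ , s′∈ , λ j →
      trans (reflexive (≡.cong (A m) (≡.sym (ℕP.+-suc i j)))) (trans (H≈ (suc j)) (eq j))

    Q : ℕ → Carrier
    Q n = sum n (λ i → t ^ (m ℕ.* i))

    -- The row of index a m + b, where b < m.
    Y : ℕ → ℕ → Row
    Y a zero    j = sgn (suc a ℕ.* m) * Q a * A 0 j + t ^ (a ℕ.* m) * A (suc a ℕ.* m) j
    Y a (suc b) j = sgn (suc a ℕ.* m ℕ.+ suc b) * ((1# + t ^ suc b) * Q a) * A 0 j +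
      t ^ (a ℕ.* m) * (A (suc a ℕ.* m ∸ suc b) j + t ^ suc b * A (suc a ℕ.* m ℕ.+ suc b) j)

    Q-step : ∀ a → Q (suc a) ≈ Q a + t ^ (a ℕ.* m)
    Q-step a = +-congˡ (reflexive (≡.cong (t ^_) (ℕP.*-comm m a)))

    -- Peels off the opposite end from `Q-step`. `B-Y` needs both forms at once, one for each
    -- summand of `(1# + T) * Q (suc a)`.
    Q-step′ : ∀ a → Q (suc a) ≈ 1# + t ^ m * Q a
    Q-step′ a = trans (sum-first a _) (+-cong (reflexive (≡.cong (t ^_) (ℕP.*-zeroʳ m)))
      (trans (sum-cong a λ i _ → trans (reflexive (≡.cong (t ^_) (ℕP.*-suc m i))) (^-homo-* t m (m ℕ.* i))) (sum-*ˡ a _ _)))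

    private
      B-Y₀ : ∀ b x → suc b ℕ.+ suc x ≡ m → ∀ j → B (suc b) j ≈ Y 0 (suc b) j
      B-Y₀ b x eq j = begin
        A± m (suc b) j + t ^ suc b * A (m ℕ.+ suc b) j
          ≈⟨ +-congʳ (trans (reflexive (≡.cong (λ k → A± k (suc b) j) (≡.sym eq))) (A±-above (suc b) (suc x) j)) ⟩
        A (suc x) j + t ^ suc b * A (m ℕ.+ suc b) j
          ≈⟨ solve 6 (λ s u a c p d → c :+ p :* d := s :* (u :* con (+ 0)) :* a :+ con (+ 1) :* (c :+ p :* d)) refl
               (sgn (1 ℕ.* m ℕ.+ suc b)) (1# + t ^ suc b) (A 0 j) _ _ _ ⟩
        sgn (1 ℕ.* m ℕ.+ suc b) * ((1# + t ^ suc b) * 0#) * A 0 j + 1# * (A (suc x) j + t ^ suc b * A (m ℕ.+ suc b) j)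
          ≡⟨ ≡.cong₂ (λ k l → sgn (1 ℕ.* m ℕ.+ suc b) * ((1# + t ^ suc b) * 0#) * A 0 j + 1# * (A k j + t ^ suc b * A (l ℕ.+ suc b) j))
               (≡.sym (≡.trans (≡.cong (_∸ suc b) (≡.trans (ℕP.+-identityʳ m) (≡.sym eq))) (ℕP.m+n∸m≡n (suc b) (suc x))))
               (≡.sym (ℕP.+-identityʳ m)) ⟩
        Y 0 (suc b) j ∎

      B-positive : ∀ {k} → 0 < k → ∀ j → B k j ≈ A± m k j + t ^ k * A (m ℕ.+ k) j
      B-positive {suc k} _ j = refl

      B-above : ∀ {k} q → k ≡ m ℕ.+ q → ∀ j → B k j ≈ A⁻ q j + t ^ k * A (m ℕ.+ k) j
      B-above q ≡.refl j = trans (B-positive (ℕP.<-≤-trans (ℕ.>-nonZero⁻¹ m) (ℕP.m≤m+n m q)) j) (+-congʳ (A±-below m q j))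

      -- The negative exponent -q contributes -t^q `A q`, and q = (a+1)m - (x+1) is the lower index
      -- of the earlier row `Y a (suc x)`. Adding t^(b+1) times that row cancels this term. The
      -- upper index (a+1)m + (x+1) that comes along equals (a+2)m - (b+1), the lower index of the
      -- new row.
      B-Y : ∀ a b x → suc b ℕ.+ suc x ≡ m → ∀ j →
        B (suc a ℕ.* m ℕ.+ suc b) j ≈ Y (suc a) (suc b) j + - (t ^ suc b) * Y a (suc x) j
      B-Y a b x eq j = begin
        B k j
          ≈⟨ B-above q (ℕP.+-assoc m (a ℕ.* m) (suc b)) j ⟩
        sgn q * (1# + t ^ q) * A₀ + - (t ^ q * A q j) + t ^ k * A (m ℕ.+ k) j
          ≈⟨ +-cong (+-cong (*-congʳ (*-congˡ (+-congˡ tq))) (-‿cong (*-congʳ tq)))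
               (*-cong (trans (reflexive (≡.cong (t ^_) (ℕP.+-assoc m (a ℕ.* m) (suc b))))
                  (trans (^-homo-* t m q) (*-cong tm tq)))
                 (reflexive (≡.cong (λ l → A l j) (≡.sym (ℕP.+-assoc m (suc a ℕ.* m) (suc b)))))) ⟩
        sgn q * (1# + P * T) * A₀ + - (P * T * A q j) + T * X * (P * T) * A₊
          ≈⟨ solve 9 (λ s P T X Q a c d e →
               s :* (con (+ 1) :+ P :* T) :* a :+ :- (P :* T :* c) :+ T :* X :* (P :* T) :* e :=
               (s :* ((con (+ 1) :+ T :* X :* Q) :+ T :* (Q :+ P)) :* a :+ T :* X :* P :* (d :+ T :* e)) :+
               (:- T) :* (s :* ((con (+ 1) :+ X) :* Q) :* a :+ P :* (c :+ X :* d)))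
               refl (sgn q) P T X (Q a) A₀ (A q j) A₋ A₊ ⟩
        (sgn q * ((1# + T * X * Q a) + T * (Q a + P)) * A₀ + T * X * P * (A₋ + T * A₊)) +
        - T * (sgn q * ((1# + X) * Q a) * A₀ + P * (A q j + X * A₋))
          ≈⟨ +-cong (+-cong (*-congʳ (*-cong s₁ Q₁)) (*-cong t₁ (+-congʳ a₁)))
               (*-congˡ (+-cong (*-congʳ (*-congʳ s₂)) (*-congˡ (+-congʳ a₂)))) ⟩
        Y (suc a) (suc b) j + - (t ^ suc b) * Y a (suc x) j ∎
        where
        k q : ℕ
        k = suc a ℕ.* m ℕ.+ suc b
        q = a ℕ.* m ℕ.+ suc b
        P T X A₀ A₋ A₊ : Carrier
        P = t ^ (a ℕ.* m)
        T = t ^ suc b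
        X = t ^ suc x
        A₀ = A 0 j
        A₋ = A (suc a ℕ.* m ℕ.+ suc x) j
        A₊ = A (suc (suc a) ℕ.* m ℕ.+ suc b) j
        tq : t ^ q ≈ P * T
        tq = ^-homo-* t (a ℕ.* m) (suc b)
        tm : t ^ m ≈ T * X
        tm = trans (reflexive (≡.cong (t ^_) (≡.sym eq))) (^-homo-* t (suc b) (suc x))
        t₁ : T * X * P ≈ t ^ (suc a ℕ.* m)
        t₁ = trans (*-congʳ (sym tm)) (sym (^-homo-* t m (a ℕ.* m)))
        s₁ : sgn q ≈ sgn (suc (suc a) ℕ.* m ℕ.+ suc b)
        s₁ = sym (trans (reflexive (≡.cong sgn (2+a-upper a (suc b) m))) (sgn-shift q m))
        s₂ : sgn q ≈ sgn (suc a ℕ.* m ℕ.+ suc x)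
        s₂ = sym (trans (reflexive (≡.cong sgn (1+a-upper a eq))) (sgn-shift q (suc x)))
        a₁ : A₋ ≈ A (suc (suc a) ℕ.* m ∸ suc b) j
        a₁ = reflexive (≡.cong (λ l → A l j) (≡.sym (≡.trans (≡.cong (_∸ suc b) (2+a-lower a (suc b) (suc x) eq)) (ℕP.m+n∸m≡n (suc b) _))))
        a₂ : A q j ≈ A (suc a ℕ.* m ∸ suc x) j
        a₂ = reflexive (≡.cong (λ l → A l j) (≡.sym (≡.trans (≡.cong (_∸ suc x) (1+a-lower a (suc b) (suc x) eq)) (ℕP.m+n∸m≡n (suc x) _))))
        Q₁ : (1# + T * X * Q a) + T * (Q a + P) ≈ (1# + T) * Q (suc a)
        Q₁ = trans (+-cong (trans (+-congˡ (*-congʳ (sym tm))) (sym (Q-step′ a))) (*-congˡ (sym (Q-step a))))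
               (solve 2 (λ T Q → Q :+ T :* Q := (con (+ 1) :+ T) :* Q) refl T (Q (suc a)))

      -- The lower exponent is exactly 0 here, so `A 0` appears for the first time, with coefficient
      -- `Q 1` and the even sign index 2m.
      B-Y-first : ∀ j → B m j ≈ Y 1 0 j
      B-Y-first j = begin
        B m j
          ≈⟨ B-positive (ℕ.>-nonZero⁻¹ m) j ⟩
        A± m m j + t ^ m * A (m ℕ.+ m) j
          ≈⟨ +-cong (trans (reflexive (≡.cong (λ k → A± k m j) (≡.sym (ℕP.+-identityʳ m)))) (A±-above m 0 j))
               (reflexive (≡.cong₂ (λ k l → t ^ k * A (m ℕ.+ l) j) (≡.sym (ℕP.+-identityʳ m)) (≡.sym (ℕP.+-identityʳ m)))) ⟩
        A 0 j + t ^ (1 ℕ.* m) * A (2 ℕ.* m) j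
          ≈⟨ +-congʳ (trans (sym (*-identityˡ _)) (*-congʳ (trans (sym (*-identityˡ _)) (*-cong
               (sym (trans (reflexive (≡.cong sgn (≡.cong (m ℕ.+_) (ℕP.+-identityʳ m)))) (sgn-shift 0 m)))
               (sym (trans (Q-step′ 0) (trans (+-congˡ (zeroʳ _)) (+-identityʳ _)))))))) ⟩
        Y 1 0 j ∎

      -- A multiple of m is its own mirror image, so a row `Y a 0` holds a single power of g beside
      -- `A 0`, and the row that cancels lies two blocks back instead of one.
      B-Y-multiple : ∀ a j → B (suc (suc a) ℕ.* m) j ≈ Y (suc (suc a)) 0 j + - (t ^ m) * Y a 0 j
      B-Y-multiple a j = begin
        B k j
          ≈⟨ B-above q ≡.refl j ⟩
        sgn q * (1# + t ^ q) * A₀ + - (t ^ q * A q j) + t ^ k * A (m ℕ.+ k) j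
          ≈⟨ +-congʳ (+-congˡ (-‿cong (*-congʳ (^-homo-* t m (a ℕ.* m))))) ⟩
        sgn q * (1# + t ^ q) * A₀ + - (t ^ m * P * A q j) + t ^ k * A (m ℕ.+ k) j
          ≈⟨ solve 9 (λ s W P V Q a c U d →
               s :* (con (+ 1) :+ W) :* a :+ :- (V :* P :* c) :+ U :* d :=
               (s :* ((con (+ 1) :+ V :* Q) :+ W) :* a :+ U :* d) :+ (:- V) :* (s :* Q :* a :+ P :* c))
               refl (sgn q) (t ^ q) P (t ^ m) (Q a) A₀ (A q j) (t ^ k) (A (m ℕ.+ k) j) ⟩
        (sgn q * ((1# + t ^ m * Q a) + t ^ q) * A₀ + t ^ k * A (m ℕ.+ k) j) + - (t ^ m) * Y a 0 j
          ≈⟨ +-congʳ (+-congʳ (*-congʳ (*-cong s₁ (trans (+-congʳ (sym (Q-step′ a))) (sym (Q-step (suc a))))))) ⟩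
        Y (suc (suc a)) 0 j + - (t ^ m) * Y a 0 j ∎
        where
        k q : ℕ
        k = suc (suc a) ℕ.* m
        q = suc a ℕ.* m
        P A₀ : Carrier
        P = t ^ (a ℕ.* m)
        A₀ = A 0 j
        s₁ : sgn q ≈ sgn (suc (suc (suc a)) ℕ.* m)
        s₁ = sym (trans (reflexive (≡.cong sgn (three a m))) (sgn-shift q m))
          where
          three : ∀ a m → suc (suc (suc a)) ℕ.* m ≡ suc a ℕ.* m ℕ.+ (m ℕ.+ m)
          three = solve-∀

    Yrow : ℕ → Row
    Yrow i = Y (i ℕD./ m) (i ℕD.% m)

    Yrow-at : ∀ a {b} → b < m → Yrow (a ℕ.* m ℕ.+ b) ≡ Y a b
    Yrow-at a {b} b<m = ≡.cong₂ Y
      (≡.trans (ℕD.+-distrib-/-∣ˡ {a ℕ.* m} b (ℕDiv.n∣m*n a))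
        (≡.trans (≡.cong₂ ℕ._+_ (ℕD.m*n/n≡m a m) (ℕD.m<n⇒m/n≡0 b<m)) (ℕP.+-identityʳ a)))
      (≡.trans (≡.cong (ℕD._% m) (ℕP.+-comm (a ℕ.* m) b)) (≡.trans (ℕD.[m+kn]%n≡m%n b a m) (ℕD.m<n⇒m%n≡m b<m)))

    decompose : ∀ i → Σ ℕ λ a → Σ ℕ λ b → b < m × i ≡ a ℕ.* m ℕ.+ b
    decompose i = i ℕD./ m , i ℕD.% m , ℕD.m%n<n i m ,
      ≡.trans (ℕD.m≡m%n+[m/n]*n i m) (ℕP.+-comm (i ℕD.% m) _)

    private
      gap : ∀ {b} → suc b < m → Σ ℕ λ x → suc b ℕ.+ suc x ≡ m
      gap {b} b<m with ℕP.m≤n⇒∃[o]m+o≡n b<m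
      ... | x , eq = x , ≡.trans (ℕP.+-suc (suc b) x) eq

      unchanged : ∀ i a {b} → i ≡ a ℕ.* m ℕ.+ b → b < m → B i ≋ Y a b → B i ≡ i mod-span Yrow
      unchanged i a ≡.refl b<m B≋Y = (λ _ → 0#) , span-0 (λ _ → refl) , λ j →
        trans (B≋Y j) (trans (reflexive (≡.cong (λ r → r j) (≡.sym (Yrow-at a b<m)))) (sym (+-identityʳ _)))

      reduced : ∀ i a {b} a′ {b′} c → i ≡ a ℕ.* m ℕ.+ b → b < m → b′ < m → a′ ℕ.* m ℕ.+ b′ < i →
        (∀ j → B i j ≈ Y a b j + c * Y a′ b′ j) → B i ≡ i mod-span Yrow
      reduced i a a′ {b′} c ≡.refl b<m b′<m l<i B≋ =
        (λ j → 0# + c * Y a′ b′ j) ,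
        span-+ (a′ ℕ.* m ℕ.+ b′) c l<i (span-0 (λ _ → refl))
          (λ j → +-congˡ (*-congˡ (reflexive (≡.cong (λ r → r j) (≡.sym (Yrow-at a′ b′<m)))))) ,
        λ j → trans (B≋ j) (+-cong (reflexive (≡.cong (λ r → r j) (≡.sym (Yrow-at a b<m)))) (sym (+-identityˡ _)))

      0<m : 0 < m
      0<m = ℕ.>-nonZero⁻¹ m

      B-mod-Y-at : ∀ a b → b < m → B (a ℕ.* m ℕ.+ b) ≡ a ℕ.* m ℕ.+ b mod-span Yrow
      B-mod-Y-at zero zero b<m = unchanged 0 0 ≡.refl b<m λ j → begin
        A m j
          ≈⟨ solve 3 (λ s a b → b := s :* con (+ 0) :* a :+ con (+ 1) :* b) refl (sgn (1 ℕ.* m)) (A 0 j) (A m j) ⟩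
        sgn (1 ℕ.* m) * 0# * A 0 j + 1# * A m j
          ≡⟨ ≡.cong (λ k → sgn (1 ℕ.* m) * 0# * A 0 j + 1# * A k j) (≡.sym (ℕP.+-identityʳ m)) ⟩
        Y 0 0 j ∎
      B-mod-Y-at zero (suc b) b<m with gap b<m
      ... | x , eq = unchanged (suc b) 0 ≡.refl b<m (B-Y₀ b x eq)
      B-mod-Y-at (suc zero) zero b<m = unchanged _ 1 ≡.refl b<m λ j →
        trans (reflexive (≡.cong (λ k → B k j) (≡.trans (ℕP.+-identityʳ (m ℕ.+ 0)) (ℕP.+-identityʳ m)))) (B-Y-first j)
      B-mod-Y-at (suc (suc a)) zero b<m = reduced _ (suc (suc a)) a (- (t ^ m)) ≡.refl b<m b<m
        (ℕP.+-monoˡ-< 0 (ℕP.<-≤-trans (ℕP.m<n+m (a ℕ.* m) 0<m) (ℕP.m≤n+m (m ℕ.+ a ℕ.* m) m)))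
        λ j → trans (reflexive (≡.cong (λ k → B k j) (ℕP.+-identityʳ (suc (suc a) ℕ.* m)))) (B-Y-multiple a j)
      B-mod-Y-at (suc a) (suc b) b<m with gap b<m
      ... | x , eq = reduced _ (suc a) a (- (t ^ suc b)) ≡.refl b<m x<m
        (ℕP.<-≤-trans (ℕP.+-monoʳ-< (a ℕ.* m) x<m)
          (≡.subst (_≤ suc a ℕ.* m ℕ.+ suc b) (ℕP.+-comm m (a ℕ.* m)) (ℕP.m≤m+n (suc a ℕ.* m) (suc b))))
        (B-Y a b x eq)
        where
        x<m : suc x < m
        x<m = ≡.subst (suc x <_) eq (ℕP.m<n+m (suc x) (s≤s z≤n))

    B-mod-Y : ∀ i → B i ≡ i mod-span Yrow
    B-mod-Y i with decompose i
    ... | a , b , b<m , ≡.refl = B-mod-Y-at a b b<m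

    -- Leading entries and evaluation of the determinant

    D-H≈D-Y : ∀ n → D n H ≈ D n Yrow
    D-H≈D-Y n = trans (D-unitriangular n H B (λ i _ → H-mod-B i)) (D-unitriangular n B Yrow (λ i _ → B-mod-Y i))

    -- In these columns the term of upper index has not started yet, and `A 0` lives in column 0
    -- alone, which is why the column is written as a successor.
    Y-initial : ∀ a {b l} → b ℕ.+ l ≡ m → ∀ c → suc c ≤ a ℕ.* m ℕ.+ l →
      Y a b (suc c) ≈ t ^ (a ℕ.* m) * A (a ℕ.* m ℕ.+ l) (suc c)
    Y-initial a {zero} ≡.refl c _ = trans (+-cong (zeroʳ _) (reflexive
      (≡.cong (λ k → t ^ (a ℕ.* m) * A k (suc c)) (ℕP.+-comm m (a ℕ.* m))))) (+-identityˡ _)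
    Y-initial a {suc b} {l} eq c c< = trans (+-cong (zeroʳ _) (*-congˡ (+-cong
      (reflexive (≡.cong (λ k → A k (suc c)) (≡.trans (≡.cong (_∸ suc b) lower) (ℕP.m+n∸m≡n (suc b) _))))
      (trans (*-congˡ (A-below (ℕP.≤-<-trans c< (ℕP.≤-<-trans
        (≡.subst (a ℕ.* m ℕ.+ l ≤_) (≡.sym lower) (ℕP.m≤n+m _ (suc b))) (ℕP.m<m+n _ (s≤s z≤n)))))) (zeroʳ _)))))
      (trans (+-identityˡ _) (*-congˡ (+-identityʳ _)))
      where
      lower : suc a ℕ.* m ≡ suc b ℕ.+ (a ℕ.* m ℕ.+ l)
      lower = 1+a-lower a l (suc b) (≡.trans (ℕP.+-comm l (suc b)) eq)

    Y-zero : ∀ a {b l} → b ℕ.+ l ≡ m → ∀ c → suc c < a ℕ.* m ℕ.+ l → Y a b (suc c) ≈ 0#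
    Y-zero a eq c c< = trans (Y-initial a eq c (ℕP.<⇒≤ c<)) (trans (*-congˡ (A-below c<)) (zeroʳ _))

    Y-lead : ∀ a {b l} → b ℕ.+ l ≡ m → ∀ c → suc c ≡ a ℕ.* m ℕ.+ l → Y a b (suc c) ≈ t ^ (a ℕ.* m)
    Y-lead a {b} {l} eq c c≡ = trans (Y-initial a eq c (ℕP.≤-reflexive c≡))
      (trans (*-congˡ (trans (reflexive (≡.cong (A (a ℕ.* m ℕ.+ l)) c≡)) (A-diagonal (a ℕ.* m ℕ.+ l)))) (*-identityʳ _))

    -- The offset `a` is there for the induction, since `blockProduct` shifts its sequence. At
    -- `a = 0` the full blocks contribute m^2 (0 + 1 + ... + (n-1)) and the last block n m s.
    blockProduct-power : ∀ a n s →
      blockProduct m (λ i → t ^ ((a ℕ.+ i) ℕ.* m)) n s ≈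
      t ^ (m ℕ.* m ℕ.* (triangle n ℕ.+ a ℕ.* n) ℕ.+ (a ℕ.+ n) ℕ.* m ℕ.* s)
    blockProduct-power a zero s = trans (^-assocʳ t ((a ℕ.+ 0) ℕ.* m) s) (reflexive (≡.cong (t ^_) (exponent a m s)))
      where
      exponent : ∀ a m s → (a ℕ.+ 0) ℕ.* m ℕ.* s ≡ m ℕ.* m ℕ.* (0 ℕ.+ a ℕ.* 0) ℕ.+ (a ℕ.+ 0) ℕ.* m ℕ.* s
      exponent = solve-∀
    blockProduct-power a (suc n) s = begin
      (t ^ ((a ℕ.+ 0) ℕ.* m)) ^ m * blockProduct m (λ i → t ^ ((a ℕ.+ suc i) ℕ.* m)) n s
        ≈⟨ *-cong (^-assocʳ t ((a ℕ.+ 0) ℕ.* m) m) (blockProduct-cong n (λ i → reflexive (≡.cong (λ k → t ^ (k ℕ.* m)) (ℕP.+-suc a i)))) ⟩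
      t ^ ((a ℕ.+ 0) ℕ.* m ℕ.* m) * blockProduct m (λ i → t ^ ((suc a ℕ.+ i) ℕ.* m)) n s
        ≈⟨ *-congˡ (blockProduct-power (suc a) n s) ⟩
      t ^ ((a ℕ.+ 0) ℕ.* m ℕ.* m) * t ^ (m ℕ.* m ℕ.* (triangle n ℕ.+ suc a ℕ.* n) ℕ.+ (suc a ℕ.+ n) ℕ.* m ℕ.* s)
        ≈⟨ trans (sym (^-homo-* t ((a ℕ.+ 0) ℕ.* m ℕ.* m) (m ℕ.* m ℕ.* (triangle n ℕ.+ suc a ℕ.* n) ℕ.+ (suc a ℕ.+ n) ℕ.* m ℕ.* s)))
          (reflexive (≡.cong (t ^_) (exponent a m n s (triangle n)))) ⟩
      t ^ (m ℕ.* m ℕ.* (triangle (suc n) ℕ.+ a ℕ.* suc n) ℕ.+ (a ℕ.+ suc n) ℕ.* m ℕ.* s) ∎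
      where
      exponent : ∀ a m n s w → (a ℕ.+ 0) ℕ.* m ℕ.* m ℕ.+ (m ℕ.* m ℕ.* (w ℕ.+ suc a ℕ.* n) ℕ.+ (suc a ℕ.+ n) ℕ.* m ℕ.* s) ≡
        m ℕ.* m ℕ.* (n ℕ.+ w ℕ.+ a ℕ.* suc n) ℕ.+ (a ℕ.+ suc n) ℕ.* m ℕ.* s
      exponent = solve-∀
      ^-congˡ : ∀ {x y} k → x ≈ y → x ^ k ≈ y ^ k
      ^-congˡ zero    x≈y = refl
      ^-congˡ (suc k) x≈y = *-cong x≈y (^-congˡ k x≈y)
      blockProduct-cong : ∀ n {u v : ℕ → Carrier} → (∀ i → u i ≈ v i) → blockProduct m u n s ≈ blockProduct m v n s
      blockProduct-cong zero    u≈v = ^-congˡ s (u≈v 0)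
      blockProduct-cong (suc n) u≈v = *-cong (^-congˡ m (u≈v 0)) (blockProduct-cong n (λ i → u≈v (suc i)))

    private
      remaining : ℕ → ℕ → Row
      remaining n i c = Yrow (skip (n ℕ.* m) i) (suc c)

    -- The leading column (n+1)m of `Y n 0` lies outside the matrix for every s < m, so inside the
    -- matrix only the entry of this row in column 0 is left.
    D-H-expand : ∀ n s → s < m → D (suc (n ℕ.* m ℕ.+ s)) H ≈
      sgn (n ℕ.* m) * (sgn (suc n ℕ.* m) * Q n * D (n ℕ.* m ℕ.+ s) (remaining n))
    D-H-expand n s s<m = begin
      D (suc (n ℕ.* m ℕ.+ s)) H
        ≈⟨ trans (D-H≈D-Y _) (D-move _ (n ℕ.* m) Yrow (s≤s (ℕP.m≤m+n _ s))) ⟩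
      sgn (n ℕ.* m) * D (suc (n ℕ.* m ℕ.+ s)) (Yrow (n ℕ.* m) ◂ (λ i → Yrow (skip (n ℕ.* m) i)))
        ≈⟨ *-congˡ (D-first-row (n ℕ.* m ℕ.+ s) _ _ λ j j< →
             trans (reflexive (≡.cong (λ r → r (suc j)) at)) (Y-zero n ≡.refl j (ℕP.≤-<-trans j< (ℕP.+-monoʳ-< (n ℕ.* m) s<m)))) ⟩
      sgn (n ℕ.* m) * (Yrow (n ℕ.* m) 0 * D (n ℕ.* m ℕ.+ s) (remaining n))
        ≈⟨ *-congˡ (*-congʳ (trans (reflexive (≡.cong (λ r → r 0) at))
             (trans (+-cong (*-identityʳ _) (trans (*-congˡ (A-below (ℕP.<-≤-trans 0<m (ℕP.m≤m+n m _)))) (zeroʳ _))) (+-identityʳ _)))) ⟩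
      sgn (n ℕ.* m) * (sgn (suc n ℕ.* m) * Q n * D (n ℕ.* m ℕ.+ s) (remaining n)) ∎
      where
      at : Yrow (n ℕ.* m) ≡ Y n 0
      at = ≡.trans (≡.cong Yrow (≡.sym (ℕP.+-identityʳ _))) (Yrow-at n 0<m)

    private
      early : ∀ n a {b} → a < n → b < m → remaining n (a ℕ.* m ℕ.+ b) ≡ λ c → Y a b (suc c)
      early n a {b} a<n b<m = ≡.cong (λ r c → r (suc c)) (≡.trans (≡.cong Yrow (skip-<
        (ℕP.<-≤-trans (ℕP.+-monoʳ-< (a ℕ.* m) b<m) (≡.subst (_≤ n ℕ.* m) (ℕP.+-comm m _) (ℕP.*-monoˡ-≤ m a<n))))) (Yrow-at a b<m))

      late : ∀ n {b} → suc b < m → remaining n (n ℕ.* m ℕ.+ b) ≡ λ c → Y n (suc b) (suc c)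
      late n {b} b<m = ≡.cong (λ r c → r (suc c)) (≡.trans (≡.cong Yrow (≡.trans (skip-≥ (ℕP.m≤m+n _ b)) (≡.sym (ℕP.+-suc _ b)))) (Yrow-at n b<m))

      Yrow-zero : ∀ a i c → a ℕ.* m ≤ i → c < a ℕ.* m → Yrow i (suc c) ≈ 0#
      Yrow-zero a i c am≤i c<am with decompose i
      ... | a′ , b , b<m , ≡.refl with ℕP.m≤n⇒∃[o]m+o≡n b<m
      ... | x , eq = trans (reflexive (≡.cong (λ r → r (suc c)) (Yrow-at a′ b<m)))
        (Y-zero a′ {b} {suc x} (≡.trans (ℕP.+-suc b x) eq) c
          (ℕP.≤-<-trans (ℕP.≤-trans c<am (ℕP.*-monoˡ-≤ m a≤a′)) (ℕP.m<m+n (a′ ℕ.* m) (s≤s z≤n))))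
        where
        a≤a′ : a ≤ a′
        a≤a′ = ℕP.≤-pred (ℕP.*-cancelʳ-< m a (suc a′) (ℕP.≤-<-trans am≤i
          (≡.subst (a′ ℕ.* m ℕ.+ b <_) (ℕP.+-comm (a′ ℕ.* m) m) (ℕP.+-monoʳ-< (a′ ℕ.* m) b<m))))

      skip-≤ : ∀ j c → c ≤ skip j c
      skip-≤ zero    c       = ℕP.n≤1+n c
      skip-≤ (suc j) zero    = z≤n
      skip-≤ (suc j) (suc c) = s≤s (skip-≤ j c)

    -- The hypothesis on `b` and `x` says that the leading entries of the last `s` rows fill the
    -- antidiagonal of the last block. It covers s = 0, where it is vacuous, and s = m - 1.
    D-H-nonzero : ∀ n s → s < m → (∀ b x → suc (b ℕ.+ x) ≡ s → suc b ℕ.+ suc x ≡ m) →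
      D (suc (n ℕ.* m ℕ.+ s)) H ≈
      sgn (m ℕ.+ (n ℕ.* triangle m ℕ.+ triangle s)) * t ^ (m ℕ.* m ℕ.* triangle n ℕ.+ n ℕ.* m ℕ.* s) * Q n
    D-H-nonzero n s s<m full = begin
      D (suc (n ℕ.* m ℕ.+ s)) H
        ≈⟨ D-H-expand n s s<m ⟩
      sgn (n ℕ.* m) * (sgn (suc n ℕ.* m) * Q n * D (n ℕ.* m ℕ.+ s) (remaining n))
        ≈⟨ *-congˡ (*-congˡ (D-antitriangular-blocks m n s (λ a → t ^ (a ℕ.* m)) (remaining n)
             (λ a b x a<n eq → trans (reflexive (≡.cong (λ r → r (a ℕ.* m ℕ.+ x)) (early n a a<n (small eq))))
               (Y-lead a {b} {suc x} (≡.trans (ℕP.+-suc b x) eq) _ (≡.sym (ℕP.+-suc _ x))))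
             (λ a b x c a<n eq c< → trans (reflexive (≡.cong (λ r → r c) (early n a a<n (small eq))))
               (Y-zero a {b} {suc x} (≡.trans (ℕP.+-suc b x) eq) c (≡.subst (suc c <_) (≡.sym (ℕP.+-suc _ x)) (s≤s c<))))
             (λ b x eq → trans (reflexive (≡.cong (λ r → r (n ℕ.* m ℕ.+ x)) (late n (small′ eq))))
               (Y-lead n {suc b} {suc x} (full b x eq) _ (≡.sym (ℕP.+-suc _ x))))
             (λ b x c eq c< → trans (reflexive (≡.cong (λ r → r c) (late n (small′ eq))))
               (Y-zero n {suc b} {suc x} (full b x eq) c (≡.subst (suc c <_) (≡.sym (ℕP.+-suc _ x)) (s≤s c<))))
             (λ a i c _ am≤i c<am → Yrow-zero a _ c (ℕP.≤-trans am≤i (skip-≤ _ i)) c<am))) ⟩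
      sgn (n ℕ.* m) * (sgn (suc n ℕ.* m) * Q n * (sgn w * blockProduct m (λ a → t ^ (a ℕ.* m)) n s))
        ≈⟨ *-cong refl (*-cong (*-congʳ (sgn-+ m (n ℕ.* m))) (*-congˡ (trans (blockProduct-power 0 n s)
             (reflexive (≡.cong (λ e → t ^ (m ℕ.* m ℕ.* e ℕ.+ n ℕ.* m ℕ.* s)) (ℕP.+-identityʳ (triangle n))))))) ⟩
      -- The cost of lifting row n m and the sign carried by that row share the factor
      -- `sgn (n ℕ.* m)`, so only `sgn m` survives.
      sgn (n ℕ.* m) * (sgn m * sgn (n ℕ.* m) * Q n * (sgn w * t ^ e))
        ≈⟨ solve 5 (λ a b c d e → a :* (b :* a :* c :* (d :* e)) := a :* a :* (b :* d :* e :* c)) refl _ _ _ _ _ ⟩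
      sgn (n ℕ.* m) * sgn (n ℕ.* m) * (sgn m * sgn w * t ^ e * Q n)
        ≈⟨ trans (*-congʳ (sgn-square (n ℕ.* m))) (*-identityˡ _) ⟩
      sgn m * sgn w * t ^ e * Q n
        ≈⟨ *-congʳ (*-congʳ (sgn-+ m w)) ⟨
      sgn (m ℕ.+ w) * t ^ e * Q n ∎
      where
      w e : ℕ
      w = n ℕ.* triangle m ℕ.+ triangle s
      e = m ℕ.* m ℕ.* triangle n ℕ.+ n ℕ.* m ℕ.* s
      small : ∀ {b x} → suc (b ℕ.+ x) ≡ m → b < m
      small {b} {x} eq = ≡.subst (suc b ≤_) eq (s≤s (ℕP.m≤m+n b x))
      small′ : ∀ {b x} → suc (b ℕ.+ x) ≡ s → suc b < m
      small′ {b} {x} eq = ℕP.≤-<-trans (≡.subst (suc b ≤_) eq (s≤s (ℕP.m≤m+n b x))) s<m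

    D-H-zero : ∀ n s → suc (suc s) < m → D (suc (n ℕ.* m ℕ.+ suc s)) H ≈ 0#
    D-H-zero n s s<m = trans (D-H-expand n (suc s) (ℕP.<-trans (ℕP.n<1+n _) s<m))
      (trans (*-congˡ (trans (*-congˡ vanishes) (zeroʳ _))) (zeroʳ _))
      where
      size : n ℕ.* m ℕ.+ suc s ≡ suc (n ℕ.* m ℕ.+ s)
      size = ℕP.+-suc (n ℕ.* m) s
      row : ℕ → Row
      row = remaining n
      1<m : 1 < m
      1<m = ℕP.≤-<-trans (s≤s z≤n) s<m
      -- The row now at place n m is `Y n 1`. It starts in column n m + m - 1, beyond the last
      -- column n m + s + 1 of the original matrix.
      zero-row : ∀ c → c < suc (n ℕ.* m ℕ.+ s) → row (n ℕ.* m) c ≈ 0#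
      zero-row c c< with gap 1<m
      ... | x , eq = trans (reflexive (≡.cong (λ r → r c) (≡.trans (≡.cong row (≡.sym (ℕP.+-identityʳ _))) (late n 1<m))))
        (Y-zero n {1} {suc x} eq c (ℕP.<-≤-trans (s≤s c<)
          (≡.subst (_≤ n ℕ.* m ℕ.+ suc x) (≡.trans (ℕP.+-suc _ (suc s)) (≡.cong suc size))
            (ℕP.+-monoʳ-≤ (n ℕ.* m) (ℕP.≤-pred (≡.subst (suc (suc s) <_) (≡.sym eq) s<m))))))
      vanishes : D (n ℕ.* m ℕ.+ suc s) row ≈ 0#
      vanishes = begin
        D (n ℕ.* m ℕ.+ suc s) row ≡⟨ ≡.cong (λ k → D k row) size ⟩
        D (suc (n ℕ.* m ℕ.+ s)) row ≈⟨ D-move _ (n ℕ.* m) row (s≤s (ℕP.m≤m+n _ s)) ⟩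
        sgn (n ℕ.* m) * D (suc (n ℕ.* m ℕ.+ s)) (move (n ℕ.* m) row)
          ≈⟨ trans (*-congˡ (D-zero-row _ _ zero-row)) (zeroʳ _) ⟩
        0# ∎

-- Coefficient sequences as a commutative ring

sumℤ-cong : ∀ n {f g} → (∀ i → i < n → f i ≡ g i) → sumℤ n f ≡ sumℤ n g
sumℤ-cong zero    f≡g = ≡.refl
sumℤ-cong (suc n) f≡g = ≡.cong₂ ℤ._+_ (sumℤ-cong n λ i i<n → f≡g i (ℕP.m<n⇒m<1+n i<n)) (f≡g n ℕP.≤-refl)

sumℤ-zero : ∀ n {f} → (∀ i → i < n → f i ≡ + 0) → sumℤ n f ≡ + 0
sumℤ-zero zero    f≡0 = ≡.refl
sumℤ-zero (suc n) f≡0 = ≡.cong₂ ℤ._+_ (sumℤ-zero n λ i i<n → f≡0 i (ℕP.m<n⇒m<1+n i<n)) (f≡0 n ℕP.≤-refl)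

sumℤ-first : ∀ n f → sumℤ (suc n) f ≡ f 0 ℤ.+ sumℤ n (λ i → f (suc i))
sumℤ-first zero    f = ℤP.+-comm (+ 0) (f 0)
sumℤ-first (suc n) f = ≡.trans (≡.cong (ℤ._+ f (suc n)) (sumℤ-first n f)) (ℤP.+-assoc (f 0) _ _)

sumℤ-+ : ∀ n f g → sumℤ n (λ i → f i ℤ.+ g i) ≡ sumℤ n f ℤ.+ sumℤ n g
sumℤ-+ zero    f g = ≡.refl
sumℤ-+ (suc n) f g = ≡.trans (≡.cong (ℤ._+ (f n ℤ.+ g n)) (sumℤ-+ n f g)) (interchange (sumℤ n f) (sumℤ n g) (f n) (g n))
  where
  interchange : ∀ a b c d → a ℤ.+ b ℤ.+ (c ℤ.+ d) ≡ a ℤ.+ c ℤ.+ (b ℤ.+ d)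
  interchange = ℤS.solve-∀

sumℤ-*ˡ : ∀ n c f → sumℤ n (λ i → c ℤ.* f i) ≡ c ℤ.* sumℤ n f
sumℤ-*ˡ zero    c f = ≡.sym (ℤP.*-zeroʳ c)
sumℤ-*ˡ (suc n) c f = ≡.trans (≡.cong (ℤ._+ c ℤ.* f n) (sumℤ-*ˡ n c f)) (≡.sym (ℤP.*-distribˡ-+ c _ _))

sumℤ-pick : ∀ n i f → i < n → (∀ k → k < n → k ≢ i → f k ≡ + 0) → sumℤ n f ≡ f i
sumℤ-pick (suc n) i f i<n f≡0 with i ℕ.≟ n
... | yes ≡.refl = ≡.trans (≡.cong (ℤ._+ f n) (sumℤ-zero n λ k k<n → f≡0 k (ℕP.m<n⇒m<1+n k<n) (ℕP.<⇒≢ k<n))) (ℤP.+-identityˡ (f n))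
... | no i≢n = ≡.trans (≡.cong₂ ℤ._+_
    (sumℤ-pick n i f (ℕP.≤∧≢⇒< (ℕP.≤-pred i<n) i≢n) λ k k<n → f≡0 k (ℕP.m<n⇒m<1+n k<n))
    (f≡0 n ℕP.≤-refl (λ n≡i → i≢n (≡.sym n≡i)))) (ℤP.+-identityʳ (f i))

tail : Poly → Poly
tail p k = p (suc k)

0ₚ-coeff : ∀ k → 0ₚ k ≡ + 0
0ₚ-coeff zero    = ≡.refl
0ₚ-coeff (suc k) = ≡.refl

*ₚ-suc : ∀ p q k → (p *ₚ q) (suc k) ≡ p 0 ℤ.* q (suc k) ℤ.+ (tail p *ₚ q) k
*ₚ-suc p q k = sumℤ-first (suc k) _

*ₚ-sucʳ : ∀ p q k → (p *ₚ q) (suc k) ≡ (p *ₚ tail q) k ℤ.+ p (suc k) ℤ.* q 0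
*ₚ-sucʳ p q k = ≡.cong₂ ℤ._+_
  (sumℤ-cong (suc k) λ i i≤k → ≡.cong (λ l → p i ℤ.* q l) (ℕP.+-∸-assoc 1 (ℕP.≤-pred i≤k)))
  (≡.cong (λ l → p (suc k) ℤ.* q l) (ℕP.n∸n≡0 k))

*ₚ-cong : ∀ {p p′ q q′} → p ≈ₚ p′ → q ≈ₚ q′ → p *ₚ q ≈ₚ p′ *ₚ q′
*ₚ-cong p≈ q≈ k = sumℤ-cong (suc k) λ i _ → ≡.cong₂ ℤ._*_ (p≈ i) (q≈ (k ∸ i))

-- The two factors are peeled at opposite ends of the convolution, by `*ₚ-suc` and `*ₚ-sucʳ`.
*ₚ-comm : ∀ p q → p *ₚ q ≈ₚ q *ₚ p
*ₚ-comm p q zero    = ≡.cong (λ x → + 0 ℤ.+ x) (ℤP.*-comm (p 0) (q 0))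
*ₚ-comm p q (suc k) = begin
  (p *ₚ q) (suc k)                              ≡⟨ *ₚ-suc p q k ⟩
  p 0 ℤ.* q (suc k) ℤ.+ (tail p *ₚ q) k         ≡⟨ ≡.cong₂ ℤ._+_ (ℤP.*-comm (p 0) _) (*ₚ-comm (tail p) q k) ⟩
  q (suc k) ℤ.* p 0 ℤ.+ (q *ₚ tail p) k         ≡⟨ ℤP.+-comm (q (suc k) ℤ.* p 0) _ ⟩
  (q *ₚ tail p) k ℤ.+ q (suc k) ℤ.* p 0         ≡⟨ *ₚ-sucʳ q p k ⟨
  (q *ₚ p) (suc k)                              ∎
  where open ≡.≡-Reasoning

*ₚ-distribʳ : ∀ r p q → (p +ₚ q) *ₚ r ≈ₚ p *ₚ r +ₚ q *ₚ r
*ₚ-distribʳ r p q k = ≡.trans (sumℤ-cong (suc k) λ i _ → ℤP.*-distribʳ-+ (r (k ∸ i)) (p i) (q i)) (sumℤ-+ (suc k) _ _)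

*ₚ-scale : ∀ c p q k → ((λ i → c ℤ.* p i) *ₚ q) k ≡ c ℤ.* (p *ₚ q) k
*ₚ-scale c p q k = ≡.trans (sumℤ-cong (suc k) λ i _ → ℤP.*-assoc c (p i) (q (k ∸ i))) (sumℤ-*ˡ (suc k) c _)

*ₚ-assoc : ∀ p q r → (p *ₚ q) *ₚ r ≈ₚ p *ₚ (q *ₚ r)
*ₚ-assoc p q r zero    = lemma (p 0) (q 0) (r 0)
  where
  lemma : ∀ a b c → + 0 ℤ.+ (+ 0 ℤ.+ a ℤ.* b) ℤ.* c ≡ + 0 ℤ.+ a ℤ.* (+ 0 ℤ.+ b ℤ.* c)
  lemma = ℤS.solve-∀
*ₚ-assoc p q r (suc k) = begin
  ((p *ₚ q) *ₚ r) (suc k)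
    ≡⟨ *ₚ-suc (p *ₚ q) r k ⟩
  (p *ₚ q) 0 ℤ.* r (suc k) ℤ.+ (tail (p *ₚ q) *ₚ r) k
    -- The tail obeys a product rule: tail (p q) = p(0) tail q + (tail p) q.
    ≡⟨ ≡.cong (λ x → (p *ₚ q) 0 ℤ.* r (suc k) ℤ.+ x) (*ₚ-cong {tail (p *ₚ q)} {(λ i → p 0 ℤ.* tail q i) +ₚ tail p *ₚ q} {r} {r} (*ₚ-suc p q) (λ _ → ≡.refl) k) ⟩
  (p *ₚ q) 0 ℤ.* r (suc k) ℤ.+ (((λ i → p 0 ℤ.* tail q i) +ₚ tail p *ₚ q) *ₚ r) k
    ≡⟨ ≡.cong (λ x → (p *ₚ q) 0 ℤ.* r (suc k) ℤ.+ x) (*ₚ-distribʳ r (λ i → p 0 ℤ.* tail q i) (tail p *ₚ q) k) ⟩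
  (p *ₚ q) 0 ℤ.* r (suc k) ℤ.+ (((λ i → p 0 ℤ.* tail q i) *ₚ r) k ℤ.+ ((tail p *ₚ q) *ₚ r) k)
    ≡⟨ ≡.cong₂ (λ x y → (p *ₚ q) 0 ℤ.* r (suc k) ℤ.+ (x ℤ.+ y)) (*ₚ-scale (p 0) (tail q) r k) (*ₚ-assoc (tail p) q r k) ⟩
  (p *ₚ q) 0 ℤ.* r (suc k) ℤ.+ (p 0 ℤ.* (tail q *ₚ r) k ℤ.+ (tail p *ₚ (q *ₚ r)) k)
    ≡⟨ lemma (p 0) (q 0) (r (suc k)) _ _ ⟩
  p 0 ℤ.* (q 0 ℤ.* r (suc k) ℤ.+ (tail q *ₚ r) k) ℤ.+ (tail p *ₚ (q *ₚ r)) k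
    ≡⟨ ≡.cong (λ x → p 0 ℤ.* x ℤ.+ (tail p *ₚ (q *ₚ r)) k) (*ₚ-suc q r k) ⟨
  p 0 ℤ.* (q *ₚ r) (suc k) ℤ.+ (tail p *ₚ (q *ₚ r)) k
    ≡⟨ *ₚ-suc p (q *ₚ r) k ⟨
  (p *ₚ (q *ₚ r)) (suc k) ∎
  where
  open ≡.≡-Reasoning
  lemma : ∀ a b c x y → (+ 0 ℤ.+ a ℤ.* b) ℤ.* c ℤ.+ (a ℤ.* x ℤ.+ y) ≡ a ℤ.* (b ℤ.* c ℤ.+ x) ℤ.+ y
  lemma = ℤS.solve-∀

const-*ₚ : ∀ c p k → (const c *ₚ p) k ≡ c ℤ.* p k
const-*ₚ c p zero    = ℤP.+-identityˡ _
const-*ₚ c p (suc k) = ≡.trans (*ₚ-suc (const c) p k)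
  (≡.trans (≡.cong (λ x → c ℤ.* p (suc k) ℤ.+ x) (sumℤ-zero (suc k) λ i _ → ℤP.*-zeroˡ (p (k ∸ i)))) (ℤP.+-identityʳ _))

*ₚ-identityˡ : ∀ p → 1ₚ *ₚ p ≈ₚ p
*ₚ-identityˡ p k = ≡.trans (const-*ₚ (+ 1) p k) (ℤP.*-identityˡ (p k))

polyRing : CommutativeRing 0ℓ 0ℓ
polyRing = record
  { Carrier = Poly ; _≈_ = _≈ₚ_ ; _+_ = _+ₚ_ ; _*_ = _*ₚ_ ; -_ = -ₚ_ ; 0# = 0ₚ ; 1# = 1ₚ
  ; isCommutativeRing = record
    { isRing = record
      { +-isAbelianGroup = record
        { isGroup = record
          { isMonoid = record
            { isSemigroup = record
              { isMagma = record
                { isEquivalence = record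
                  { refl  = λ _ → ≡.refl
                  ; sym   = λ p≈q k → ≡.sym (p≈q k)
                  ; trans = λ p≈q q≈r k → ≡.trans (p≈q k) (q≈r k)
                  }
                ; ∙-cong = λ p≈ q≈ k → ≡.cong₂ ℤ._+_ (p≈ k) (q≈ k)
                }
              ; assoc = λ p q r k → ℤP.+-assoc (p k) (q k) (r k)
              }
            ; identity =
                (λ p k → ≡.trans (≡.cong (ℤ._+ p k) (0ₚ-coeff k)) (ℤP.+-identityˡ (p k))) ,
                (λ p k → ≡.trans (≡.cong (λ x → p k ℤ.+ x) (0ₚ-coeff k)) (ℤP.+-identityʳ (p k)))
            }
          ; inverse =
              (λ p k → ≡.trans (ℤP.+-inverseˡ (p k)) (≡.sym (0ₚ-coeff k))) ,
              (λ p k → ≡.trans (ℤP.+-inverseʳ (p k)) (≡.sym (0ₚ-coeff k)))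
          ; ⁻¹-cong = λ p≈ k → ≡.cong ℤ.-_ (p≈ k)
          }
        ; comm = λ p q k → ℤP.+-comm (p k) (q k)
        }
      ; *-cong     = *ₚ-cong
      ; *-assoc    = *ₚ-assoc
      ; *-identity = *ₚ-identityˡ , λ p k → ≡.trans (*ₚ-comm p 1ₚ k) (*ₚ-identityˡ p k)
      ; distrib    =
          (λ p q r k → ≡.trans (*ₚ-comm p (q +ₚ r) k)
            (≡.trans (*ₚ-distribʳ p q r k) (≡.cong₂ ℤ._+_ (*ₚ-comm q p k) (*ₚ-comm r p k)))) ,
          *ₚ-distribʳ
      }
    ; *-comm = *ₚ-comm
    }
  }

constants : ℤ-rawRing -Raw-AlmostCommutative⟶ fromCommutativeRing polyRing
constants = record
  { ⟦_⟧    = const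
  ; +-homo = λ { a b zero → ≡.refl ; a b (suc k) → ≡.refl }
  ; *-homo = λ { a b zero → ≡.sym (const-*ₚ a (const b) 0)
               ; a b (suc k) → ≡.sym (≡.trans (const-*ₚ a (const b) (suc k)) (ℤP.*-zeroʳ a)) }
  ; -‿homo = λ { a zero → ≡.refl ; a (suc k) → ≡.refl }
  ; 0-homo = λ _ → ≡.refl
  ; 1-homo = λ _ → ≡.refl
  }

tₚ : Poly
tₚ = tpow 1

module W = Walks polyRing constants tₚ
module K = RingKit polyRing constants
module Det = Determinant polyRing constants

t*-zero : ∀ p → (tₚ *ₚ p) 0 ≡ + 0
t*-zero p = ≡.trans (ℤP.+-identityˡ _) (ℤP.*-zeroˡ (p 0))

t*-suc : ∀ p k → (tₚ *ₚ p) (suc k) ≡ p k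
t*-suc p k = ≡.trans (*ₚ-suc tₚ p k) (≡.trans
  (≡.cong₂ ℤ._+_ (ℤP.*-zeroˡ (p (suc k)))
    (≡.trans (*ₚ-cong {tail tₚ} {1ₚ} {p} {p} (λ { zero → ≡.refl ; (suc _) → ≡.refl }) (λ _ → ≡.refl) k) (*ₚ-identityˡ p k)))
  (ℤP.+-identityˡ (p k)))

tpow≈^ : ∀ e → tpow e ≈ₚ tₚ K.^ e
tpow≈^ zero    zero    = ≡.refl
tpow≈^ zero    (suc k) = ≡.refl
tpow≈^ (suc e) zero    = ≡.sym (t*-zero (tₚ K.^ e))
tpow≈^ (suc e) (suc k) = ≡.trans (tpow≈^ e k) (≡.sym (t*-suc (tₚ K.^ e) k))

sumₚ≈sum : ∀ n f → sumₚ n f ≈ₚ K.sum n f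
sumₚ≈sum zero    f k = ≡.sym (0ₚ-coeff k)
sumₚ≈sum (suc n) f k = ≡.cong (ℤ._+ f n k) (sumₚ≈sum n f k)

sign≈sgn : ∀ k → const (sign k) ≈ₚ K.sgn k
sign≈sgn zero    i       = ≡.refl
sign≈sgn (suc k) zero    = ≡.cong ℤ.-_ (sign≈sgn k zero)
sign≈sgn (suc k) (suc i) = ≡.cong ℤ.-_ (sign≈sgn k (suc i))

-- Narayana polynomials as coefficients of g

nC0≡1 : ∀ n → n C 0 ≡ 1
nC0≡1 zero    = ≡.refl
nC0≡1 (suc n) = ≡.refl

-- Absorption, (k+1) C(n,k+1) = (n-k) C(n,k), with the subtraction moved across so that k > n is
-- included.
C-absorb : ∀ n k → suc k ℕ.* (n C suc k) ℕ.+ k ℕ.* (n C k) ≡ n ℕ.* (n C k)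
C-absorb zero    zero    = ≡.refl
C-absorb zero    (suc k) = ≡.cong₂ ℕ._+_ (ℕP.*-zeroʳ (suc (suc k))) (ℕP.*-zeroʳ (suc k))
C-absorb (suc n) zero    = begin
  1 ℕ.* (suc n C 1) ℕ.+ 0       ≡⟨ ≡.cong (λ x → 1 ℕ.* x ℕ.+ 0) (nC1≡n (suc n)) ⟩
  1 ℕ.* suc n ℕ.+ 0             ≡⟨ lemma n ⟩
  suc n ℕ.* 1                   ≡⟨ ≡.cong (suc n ℕ.*_) (nC0≡1 (suc n)) ⟨
  suc n ℕ.* (suc n C 0)         ∎
  where
  open ≡.≡-Reasoning
  lemma : ∀ n → 1 ℕ.* suc n ℕ.+ 0 ≡ suc n ℕ.* 1
  lemma = solve-∀
C-absorb (suc n) (suc k) = begin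
  suc (suc k) ℕ.* (suc n C suc (suc k)) ℕ.+ suc k ℕ.* (suc n C suc k)
    ≡⟨ ≡.cong₂ (λ x y → suc (suc k) ℕ.* x ℕ.+ suc k ℕ.* y) (nCk+nC[k+1]≡[n+1]C[k+1] n (suc k)) (nCk+nC[k+1]≡[n+1]C[k+1] n k) ⟨
  suc (suc k) ℕ.* (b ℕ.+ c) ℕ.+ suc k ℕ.* (a ℕ.+ b)
    ≡⟨ split k a b c ⟩
  (suc (suc k) ℕ.* c ℕ.+ suc k ℕ.* b) ℕ.+ (suc k ℕ.* b ℕ.+ k ℕ.* a) ℕ.+ (a ℕ.+ b)
    ≡⟨ ≡.cong₂ (λ x y → x ℕ.+ y ℕ.+ (a ℕ.+ b)) (C-absorb n (suc k)) (C-absorb n k) ⟩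
  n ℕ.* b ℕ.+ n ℕ.* a ℕ.+ (a ℕ.+ b)
    ≡⟨ collect n a b ⟩
  suc n ℕ.* (a ℕ.+ b)
    ≡⟨ ≡.cong (suc n ℕ.*_) (nCk+nC[k+1]≡[n+1]C[k+1] n k) ⟩
  suc n ℕ.* (suc n C suc k) ∎
  where
  open ≡.≡-Reasoning
  a b c : ℕ
  a = n C k
  b = n C suc k
  c = n C suc (suc k)
  split : ∀ k a b c → suc (suc k) ℕ.* (b ℕ.+ c) ℕ.+ suc k ℕ.* (a ℕ.+ b) ≡
    (suc (suc k) ℕ.* c ℕ.+ suc k ℕ.* b) ℕ.+ (suc k ℕ.* b ℕ.+ k ℕ.* a) ℕ.+ (a ℕ.+ b)
  split = solve-∀
  collect : ∀ n a b → n ℕ.* b ℕ.+ n ℕ.* a ℕ.+ (a ℕ.+ b) ≡ suc n ℕ.* (a ℕ.+ b)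
  collect = solve-∀

-- For i = k + 1 this says that C(n+1,i) C(n,i) / (i+1) = C(n,i)^2 - C(n,i-1) C(n,i+1), cleared of
-- division and subtraction. Once (k+1) a b is added to both sides, absorption reduces them to a (n
-- b) and b (n a).
narayana-product : ∀ n k →
  (suc n C suc k) ℕ.* (n C suc k) ℕ.+ suc (suc k) ℕ.* ((n C k) ℕ.* (n C suc (suc k))) ≡
  suc (suc k) ℕ.* ((n C suc k) ℕ.* (n C suc k))
narayana-product n k = ℕP.+-cancelʳ-≡ (suc k ℕ.* (a ℕ.* b)) _ _ (begin
  (suc n C suc k) ℕ.* b ℕ.+ suc (suc k) ℕ.* (a ℕ.* c) ℕ.+ suc k ℕ.* (a ℕ.* b)
    ≡⟨ ≡.cong (λ x → x ℕ.* b ℕ.+ suc (suc k) ℕ.* (a ℕ.* c) ℕ.+ suc k ℕ.* (a ℕ.* b)) (nCk+nC[k+1]≡[n+1]C[k+1] n k) ⟨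
  (a ℕ.+ b) ℕ.* b ℕ.+ suc (suc k) ℕ.* (a ℕ.* c) ℕ.+ suc k ℕ.* (a ℕ.* b)
    ≡⟨ factor k a b c ⟩
  (a ℕ.+ b) ℕ.* b ℕ.+ a ℕ.* (suc (suc k) ℕ.* c ℕ.+ suc k ℕ.* b)
    ≡⟨ ≡.cong (λ x → (a ℕ.+ b) ℕ.* b ℕ.+ a ℕ.* x) (C-absorb n (suc k)) ⟩
  (a ℕ.+ b) ℕ.* b ℕ.+ a ℕ.* (n ℕ.* b)
    ≡⟨ exchange n a b ⟩
  (a ℕ.+ b) ℕ.* b ℕ.+ b ℕ.* (n ℕ.* a)
    ≡⟨ ≡.cong (λ x → (a ℕ.+ b) ℕ.* b ℕ.+ b ℕ.* x) (C-absorb n k) ⟨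
  (a ℕ.+ b) ℕ.* b ℕ.+ b ℕ.* (suc k ℕ.* b ℕ.+ k ℕ.* a)
    ≡⟨ collect k a b ⟩
  suc (suc k) ℕ.* (b ℕ.* b) ℕ.+ suc k ℕ.* (a ℕ.* b) ∎)
  where
  open ≡.≡-Reasoning
  a b c : ℕ
  a = n C k
  b = n C suc k
  c = n C suc (suc k)
  factor : ∀ k a b c → (a ℕ.+ b) ℕ.* b ℕ.+ suc (suc k) ℕ.* (a ℕ.* c) ℕ.+ suc k ℕ.* (a ℕ.* b) ≡
    (a ℕ.+ b) ℕ.* b ℕ.+ a ℕ.* (suc (suc k) ℕ.* c ℕ.+ suc k ℕ.* b)
  factor = solve-∀
  exchange : ∀ n a b → (a ℕ.+ b) ℕ.* b ℕ.+ a ℕ.* (n ℕ.* b) ≡ (a ℕ.+ b) ℕ.* b ℕ.+ b ℕ.* (n ℕ.* a)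
  exchange = solve-∀
  collect : ∀ k a b → (a ℕ.+ b) ℕ.* b ℕ.+ b ℕ.* (suc k ℕ.* b ℕ.+ k ℕ.* a) ≡ suc (suc k) ℕ.* (b ℕ.* b) ℕ.+ suc k ℕ.* (a ℕ.* b)
  collect = solve-∀

exact-quotient : ∀ d N z → + suc d ℤ.* z ≡ + N → + (N ℕD./ suc d) ≡ z
exact-quotient d N (+ x)      eq = ≡.cong +_ (≡.trans (≡.cong (ℕD._/ suc d) N≡) (ℕD.m*n/n≡m x (suc d)))
  where
  N≡ : N ≡ x ℕ.* suc d
  N≡ = ≡.trans (ℤP.+-injective (≡.trans (≡.sym eq) (≡.sym (ℤP.pos-* (suc d) x)))) (ℕP.*-comm (suc d) x)
exact-quotient d N ℤ.-[1+ x ] ()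

-- The constant term in g of g^m ((1 + g)(1 + t g) / g)^k.
centred : ℕ → ℕ → Poly
centred m k i = + ((k C i) ℕ.* (k C (m ℕ.+ i)))

private
  pascal : ∀ k i → + (suc k C suc i) ≡ + (k C i) ℤ.+ + (k C suc i)
  pascal k i = ≡.cong +_ (≡.sym (nCk+nC[k+1]≡[n+1]C[k+1] k i))

  pos-product : ∀ {x y a b} → + x ≡ a → + y ≡ b → + (x ℕ.* y) ≡ a ℤ.* b
  pos-product {x} {y} ≡.refl ≡.refl = ℤP.pos-* x y

  [1+t]* : ∀ p → (1ₚ +ₚ tₚ) *ₚ p ≈ₚ p +ₚ tₚ *ₚ p
  [1+t]* p k = ≡.trans (*ₚ-distribʳ p 1ₚ tₚ k) (≡.cong (ℤ._+ (tₚ *ₚ p) k) (*ₚ-identityˡ p k))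

  [1+t]*-zero : ∀ p → ((1ₚ +ₚ tₚ) *ₚ p) 0 ≡ p 0
  [1+t]*-zero p = ≡.trans ([1+t]* p 0) (≡.trans (≡.cong (λ x → p 0 ℤ.+ x) (t*-zero p)) (ℤP.+-identityʳ (p 0)))

  [1+t]*-suc : ∀ p k → ((1ₚ +ₚ tₚ) *ₚ p) (suc k) ≡ p (suc k) ℤ.+ p k
  [1+t]*-suc p k = ≡.trans ([1+t]* p (suc k)) (≡.cong (λ x → p (suc k) ℤ.+ x) (t*-suc p k))

-- One factor z = g^-1 + (1 + t) + t g is split off. On coefficients it is the product of two Pascal
-- rules.
centred-step : ∀ m k → centred (suc m) (suc k) ≈ₚ
  centred m k +ₚ (1ₚ +ₚ tₚ) *ₚ centred (suc m) k +ₚ tₚ *ₚ centred (suc (suc m)) k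
centred-step m k zero = begin
  centred (suc m) (suc k) 0
    ≡⟨ pos-product (≡.cong +_ (≡.trans (nC0≡1 (suc k)) (≡.sym (nC0≡1 k)))) (pascal k (m ℕ.+ 0)) ⟩
  + (k C 0) ℤ.* (+ (k C (m ℕ.+ 0)) ℤ.+ + (k C suc (m ℕ.+ 0)))
    ≡⟨ lemma (+ (k C 0)) (+ (k C (m ℕ.+ 0))) (+ (k C suc (m ℕ.+ 0))) ⟩
  + (k C 0) ℤ.* + (k C (m ℕ.+ 0)) ℤ.+ + (k C 0) ℤ.* + (k C suc (m ℕ.+ 0)) ℤ.+ + 0
    ≡⟨ ≡.cong₂ ℤ._+_ (≡.cong₂ ℤ._+_ (ℤP.pos-* (k C 0) _) (≡.trans ([1+t]*-zero (centred (suc m) k)) (ℤP.pos-* (k C 0) _)))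
         (t*-zero (centred (suc (suc m)) k)) ⟨
  (centred m k +ₚ (1ₚ +ₚ tₚ) *ₚ centred (suc m) k +ₚ tₚ *ₚ centred (suc (suc m)) k) 0 ∎
  where
  open ≡.≡-Reasoning
  lemma : ∀ a b c → a ℤ.* (b ℤ.+ c) ≡ a ℤ.* b ℤ.+ a ℤ.* c ℤ.+ + 0
  lemma = ℤS.solve-∀
centred-step m k (suc i) = begin
  centred (suc m) (suc k) (suc i)
    ≡⟨ pos-product (pascal k i) (pascal k (m ℕ.+ suc i)) ⟩
  (+ (k C i) ℤ.+ + (k C suc i)) ℤ.* (+ (k C (m ℕ.+ suc i)) ℤ.+ + (k C suc (m ℕ.+ suc i)))
    ≡⟨ lemma (+ (k C i)) (+ (k C suc i)) (+ (k C (m ℕ.+ suc i))) (+ (k C suc (m ℕ.+ suc i))) ⟩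
  + (k C suc i) ℤ.* + (k C (m ℕ.+ suc i)) ℤ.+
  (+ (k C suc i) ℤ.* + (k C suc (m ℕ.+ suc i)) ℤ.+ + (k C i) ℤ.* + (k C (m ℕ.+ suc i))) ℤ.+
  + (k C i) ℤ.* + (k C suc (m ℕ.+ suc i))
    ≡⟨ ≡.cong₂ ℤ._+_ (≡.cong₂ ℤ._+_ (ℤP.pos-* (k C suc i) _)
         (≡.trans ([1+t]*-suc (centred (suc m) k) i) (≡.cong₂ ℤ._+_ (ℤP.pos-* (k C suc i) _)
           (≡.trans (ℤP.pos-* (k C i) _) (≡.cong (λ l → + (k C i) ℤ.* + (k C l)) (≡.sym (ℕP.+-suc m i)))))))
         (≡.trans (t*-suc (centred (suc (suc m)) k) i)
           (≡.trans (ℤP.pos-* (k C i) _) (≡.cong (λ l → + (k C i) ℤ.* + (k C suc l)) (≡.sym (ℕP.+-suc m i))))) ⟨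
  (centred m k +ₚ (1ₚ +ₚ tₚ) *ₚ centred (suc m) k +ₚ tₚ *ₚ centred (suc (suc m)) k) (suc i) ∎
  where
  open ≡.≡-Reasoning
  lemma : ∀ a b c d → (a ℤ.+ b) ℤ.* (c ℤ.+ d) ≡ b ℤ.* c ℤ.+ (b ℤ.* d ℤ.+ a ℤ.* c) ℤ.+ a ℤ.* d
  lemma = ℤS.solve-∀

-- The neighbour of index -1 is written as t times the one of index 1: the substitution of 1/(t g)
-- for g fixes z and exchanges g^-1 with t g.
centred-step₀ : ∀ k → centred 0 (suc k) ≈ₚ
  tₚ *ₚ centred 1 k +ₚ (1ₚ +ₚ tₚ) *ₚ centred 0 k +ₚ tₚ *ₚ centred 1 k
centred-step₀ k zero = begin
  centred 0 (suc k) 0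
    ≡⟨ ≡.cong (λ x → + (x ℕ.* x)) (≡.trans (nC0≡1 (suc k)) (≡.sym (nC0≡1 k))) ⟩
  centred 0 k 0
    ≡⟨ ≡.trans (ℤP.+-identityʳ (+ 0 ℤ.+ centred 0 k 0)) (ℤP.+-identityˡ (centred 0 k 0)) ⟨
  + 0 ℤ.+ centred 0 k 0 ℤ.+ + 0
    ≡⟨ ≡.cong₂ ℤ._+_ (≡.cong₂ ℤ._+_ (t*-zero (centred 1 k)) ([1+t]*-zero (centred 0 k))) (t*-zero (centred 1 k)) ⟨
  (tₚ *ₚ centred 1 k +ₚ (1ₚ +ₚ tₚ) *ₚ centred 0 k +ₚ tₚ *ₚ centred 1 k) 0 ∎
  where open ≡.≡-Reasoning
centred-step₀ k (suc i) = begin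
  centred 0 (suc k) (suc i)
    ≡⟨ pos-product (pascal k i) (pascal k i) ⟩
  (a ℤ.+ b) ℤ.* (a ℤ.+ b)
    ≡⟨ lemma a b ⟩
  a ℤ.* b ℤ.+ (b ℤ.* b ℤ.+ a ℤ.* a) ℤ.+ a ℤ.* b
    ≡⟨ ≡.cong₂ ℤ._+_ (≡.cong₂ ℤ._+_ ab (≡.trans ([1+t]*-suc (centred 0 k) i)
         (≡.cong₂ ℤ._+_ (ℤP.pos-* (k C suc i) _) (ℤP.pos-* (k C i) _)))) ab ⟨
  (tₚ *ₚ centred 1 k +ₚ (1ₚ +ₚ tₚ) *ₚ centred 0 k +ₚ tₚ *ₚ centred 1 k) (suc i) ∎
  where
  open ≡.≡-Reasoning
  a b : ℤ
  a = + (k C i)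
  b = + (k C suc i)
  ab : (tₚ *ₚ centred 1 k) (suc i) ≡ a ℤ.* b
  ab = ≡.trans (t*-suc (centred 1 k) i) (ℤP.pos-* (k C i) _)
  lemma : ∀ a b → (a ℤ.+ b) ℤ.* (a ℤ.+ b) ≡ a ℤ.* b ℤ.+ (b ℤ.* b ℤ.+ a ℤ.* a) ℤ.+ a ℤ.* b
  lemma = ℤS.solve-∀

private
  centred-at-0 : ∀ m → centred m 0 ≈ₚ W.A m 0
  centred-at-0 zero    zero    = ≡.refl
  centred-at-0 zero    (suc i) = ≡.refl
  centred-at-0 (suc m) zero    = ≡.refl
  centred-at-0 (suc m) (suc i) = ≡.refl

-- Lagrange inversion for g = q φ(g) with φ = (1 + g)(1 + t g), where φ - g φ' = 1 - t g^2. The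
-- proof compares recurrences instead: at m = 0 the formula continued to index -1 gives t
-- `centred 1 k` - t `centred 1 k` = 0, in agreement with `A 0 (suc k)`.
A-closed : ∀ k m → W.A (suc m) (suc k) ≈ₚ centred m k +ₚ -ₚ (tₚ *ₚ centred (suc (suc m)) k)
A-closed zero m = K.trans {W.A (suc m) 1} {W.A m 0} {centred m 0 +ₚ -ₚ (tₚ *ₚ centred (suc (suc m)) 0)}
  (K.solve 2 (λ a t → a K.:+ (K.con (+ 1) K.:+ t) K.:* K.con (+ 0) K.:+ t K.:* K.con (+ 0) K.:= a) (λ _ → ≡.refl) (W.A m 0) tₚ)
  (λ i → ≡.trans (≡.sym (centred-at-0 m i)) (≡.trans (≡.sym (ℤP.+-identityʳ (centred m 0 i)))
    (≡.cong (λ x → centred m 0 i ℤ.+ ℤ.- x) (≡.sym (vanish i)))))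
  where
  vanish : ∀ i → (tₚ *ₚ centred (suc (suc m)) 0) i ≡ + 0
  vanish zero    = t*-zero (centred (suc (suc m)) 0)
  vanish (suc i) = ≡.trans (t*-suc (centred (suc (suc m)) 0) i) (centred-at-0-suc i)
    where
    centred-at-0-suc : ∀ i → centred (suc (suc m)) 0 i ≡ + 0
    centred-at-0-suc zero    = ≡.refl
    centred-at-0-suc (suc i) = ≡.refl
A-closed (suc k) m i = ≡.trans (expanded m i)
  (≡.sym (≡.cong₂ (λ x y → x ℤ.+ ℤ.- y) (centred≈step m i) (t-step i)))
  where
  step : ℕ → Poly
  step zero    = tₚ *ₚ centred 1 k +ₚ (1ₚ +ₚ tₚ) *ₚ centred 0 k +ₚ tₚ *ₚ centred 1 k
  step (suc m) = centred m k +ₚ (1ₚ +ₚ tₚ) *ₚ centred (suc m) k +ₚ tₚ *ₚ centred (suc (suc m)) k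
  centred≈step : ∀ m → centred m (suc k) ≈ₚ step m
  centred≈step zero    = centred-step₀ k
  centred≈step (suc m) = centred-step m k
  t-step : tₚ *ₚ centred (suc (suc m)) (suc k) ≈ₚ tₚ *ₚ step (suc (suc m))
  t-step = *ₚ-cong {tₚ} {tₚ} {centred (suc (suc m)) (suc k)} {step (suc (suc m))} (λ _ → ≡.refl) (centred≈step (suc (suc m)))
  closed : ℕ → Poly
  closed m = centred m k +ₚ -ₚ (tₚ *ₚ centred (suc (suc m)) k)
  rewritten : ∀ (a b c a′ b′ c′ : Poly) → a ≈ₚ a′ → b ≈ₚ b′ → c ≈ₚ c′ →
    a +ₚ (1ₚ +ₚ tₚ) *ₚ b +ₚ tₚ *ₚ c ≈ₚ a′ +ₚ (1ₚ +ₚ tₚ) *ₚ b′ +ₚ tₚ *ₚ c′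
  rewritten a b c a′ b′ c′ a≈ b≈ c≈ i = ≡.cong₂ ℤ._+_
    (≡.cong₂ ℤ._+_ (a≈ i) (*ₚ-cong {1ₚ +ₚ tₚ} {1ₚ +ₚ tₚ} {b} {b′} (λ _ → ≡.refl) b≈ i))
    (*ₚ-cong {tₚ} {tₚ} {c} {c′} (λ _ → ≡.refl) c≈ i)
  expanded : ∀ m → W.A (suc m) (suc (suc k)) ≈ₚ step m +ₚ -ₚ (tₚ *ₚ step (suc (suc m)))
  expanded zero i = ≡.trans
    (rewritten 0ₚ (W.A 1 (suc k)) (W.A 2 (suc k)) 0ₚ (closed 0) (closed 1) (λ _ → ≡.refl) (A-closed k 0) (A-closed k 1) i)
    (K.solve 5 (λ t a b c d →
      K.con (+ 0) K.:+ (K.con (+ 1) K.:+ t) K.:* (a K.:+ K.:- (t K.:* c)) K.:+ t K.:* (b K.:+ K.:- (t K.:* d)) K.:=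
      (t K.:* b K.:+ (K.con (+ 1) K.:+ t) K.:* a K.:+ t K.:* b) K.:+
      K.:- (t K.:* (b K.:+ (K.con (+ 1) K.:+ t) K.:* c K.:+ t K.:* d)))
      (λ _ → ≡.refl) tₚ (centred 0 k) (centred 1 k) (centred 2 k) (centred 3 k) i)
  expanded (suc m) i = ≡.trans
    (rewritten (W.A (suc m) (suc k)) (W.A (2 ℕ.+ m) (suc k)) (W.A (3 ℕ.+ m) (suc k)) (closed m) (closed (suc m)) (closed (2 ℕ.+ m))
      (A-closed k m) (A-closed k (suc m)) (A-closed k (2 ℕ.+ m)) i)
    (K.solve 6 (λ t a b c d e →
      (a K.:+ K.:- (t K.:* c)) K.:+ (K.con (+ 1) K.:+ t) K.:* (b K.:+ K.:- (t K.:* d)) K.:+ t K.:* (c K.:+ K.:- (t K.:* e)) K.:=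
      (a K.:+ (K.con (+ 1) K.:+ t) K.:* b K.:+ t K.:* c) K.:+
      K.:- (t K.:* (c K.:+ (K.con (+ 1) K.:+ t) K.:* d K.:+ t K.:* e)))
      (λ _ → ≡.refl) tₚ (centred m k) (centred (1 ℕ.+ m) k) (centred (2 ℕ.+ m) k) (centred (3 ℕ.+ m) k) (centred (4 ℕ.+ m) k) i)

tpow-same : ∀ i → tpow i i ≡ + 1
tpow-same zero    = ≡.refl
tpow-same (suc i) = tpow-same i

tpow-other : ∀ {k i} → k ≢ i → tpow k i ≡ + 0
tpow-other {zero}  {zero}  k≢i = ⊥-elim (k≢i ≡.refl)
tpow-other {zero}  {suc i} k≢i = ≡.refl
tpow-other {suc k} {zero}  k≢i = ≡.refl
tpow-other {suc k} {suc i} k≢i = tpow-other {k} {i} (λ k≡i → k≢i (≡.cong suc k≡i))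

private
  term-other : ∀ c {k i} → k ≢ i → (const c *ₚ tpow k) i ≡ + 0
  term-other c {k} {i} k≢i = ≡.trans (const-*ₚ c (tpow k) i) (≡.trans (≡.cong (λ x → c ℤ.* x) (tpow-other k≢i)) (ℤP.*-zeroʳ c))

narayana-coefficient : ∀ n i → i < suc n → narayana (suc n) i ≡ + (((suc n C i) ℕ.* (n C i)) ℕD./ suc i)
narayana-coefficient n i i<n = ≡.trans
  (sumℤ-pick (suc n) i _ i<n λ k _ k≢i → term-other _ k≢i)
  (≡.trans (const-*ₚ (+ (((suc n C i) ℕ.* (n C i)) ℕD./ suc i)) (tpow i) i)
    (≡.trans (≡.cong (λ x → + (((suc n C i) ℕ.* (n C i)) ℕD./ suc i) ℤ.* x) (tpow-same i)) (ℤP.*-identityʳ _)))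

narayana≈A : ∀ n → narayana (suc n) ≈ₚ W.A 1 (suc n)
narayana≈A n i with i ℕ.<? suc n
narayana≈A n zero | yes i<n = ≡.trans (narayana-coefficient n 0 i<n) (≡.trans
  (exact-quotient 0 ((suc n C 0) ℕ.* (n C 0)) (centred 0 n 0)
    (≡.trans (ℤP.*-identityˡ _) (≡.cong (λ x → + (x ℕ.* (n C 0))) (≡.trans (nC0≡1 n) (≡.sym (nC0≡1 (suc n)))))))
  (≡.sym (≡.trans (A-closed n 0 0) (≡.trans (≡.cong (λ x → centred 0 n 0 ℤ.+ ℤ.- x) (t*-zero (centred 2 n))) (ℤP.+-identityʳ _)))))
narayana≈A n (suc i) | yes i<n = ≡.trans (narayana-coefficient n (suc i) i<n) (≡.trans
  (exact-quotient (suc i) _ (+ (b ℕ.* b) ℤ.+ ℤ.- (+ (a ℕ.* c))) divided)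
  (≡.sym (≡.trans (A-closed n 0 (suc i)) (≡.cong (λ x → centred 0 n (suc i) ℤ.+ ℤ.- x) (t*-suc (centred 2 n) i)))))
  where
  a b c : ℕ
  a = n C i
  b = n C suc i
  c = n C suc (suc i)
  cancel : ∀ s x y → s ℤ.* (x ℤ.+ ℤ.- y) ℤ.+ s ℤ.* y ≡ s ℤ.* x
  cancel = ℤS.solve-∀
  divided : + suc (suc i) ℤ.* (+ (b ℕ.* b) ℤ.+ ℤ.- (+ (a ℕ.* c))) ≡ + ((suc n C suc i) ℕ.* b)
  divided = ℤRing.+-cancelʳ (+ suc (suc i) ℤ.* + (a ℕ.* c)) _ _ (begin
    + suc (suc i) ℤ.* (+ (b ℕ.* b) ℤ.+ ℤ.- (+ (a ℕ.* c))) ℤ.+ + suc (suc i) ℤ.* + (a ℕ.* c)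
      ≡⟨ cancel (+ suc (suc i)) (+ (b ℕ.* b)) (+ (a ℕ.* c)) ⟩
    + suc (suc i) ℤ.* + (b ℕ.* b)
      ≡⟨ ℤP.pos-* (suc (suc i)) (b ℕ.* b) ⟨
    + (suc (suc i) ℕ.* (b ℕ.* b))
      ≡⟨ ≡.cong +_ (narayana-product n i) ⟨
    + ((suc n C suc i) ℕ.* b ℕ.+ suc (suc i) ℕ.* (a ℕ.* c))
      ≡⟨ ℤP.pos-+ ((suc n C suc i) ℕ.* b) _ ⟩
    + ((suc n C suc i) ℕ.* b) ℤ.+ + (suc (suc i) ℕ.* (a ℕ.* c))
      ≡⟨ ≡.cong (λ x → + ((suc n C suc i) ℕ.* b) ℤ.+ x) (ℤP.pos-* (suc (suc i)) (a ℕ.* c)) ⟩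
    + ((suc n C suc i) ℕ.* b) ℤ.+ + suc (suc i) ℤ.* + (a ℕ.* c) ∎)
    where open ≡.≡-Reasoning
narayana≈A n zero | no i≮n = ⊥-elim (i≮n (s≤s z≤n))
narayana≈A n (suc i) | no i≮n = ≡.trans
  (sumℤ-zero (suc n) λ k k<n → term-other _ (λ k≡i → i≮n (≡.subst (_< suc n) k≡i k<n)))
  (≡.sym (≡.trans (A-closed n 0 (suc i)) (≡.cong₂ (λ x y → x ℤ.+ ℤ.- y)
    (≡.cong (λ x → + (x ℕ.* (n C suc i))) (k>n⇒nCk≡0 n<i))
    (≡.trans (t*-suc (centred 2 n) i) (≡.cong +_ (≡.trans (≡.cong ((n C i) ℕ.*_) (k>n⇒nCk≡0 (ℕP.m<n⇒m<1+n n<i))) (ℕP.*-zeroʳ (n C i))))))))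
  where
  n<i : n < suc i
  n<i = ℕP.≮⇒≥ i≮n

gammaPow≈A : ∀ m n → gammaPow m n ≈ₚ W.A m (n ℕ.+ m)
gammaPow≈A zero    zero    = λ _ → ≡.refl
gammaPow≈A zero    (suc n) = λ _ → ≡.refl
gammaPow≈A (suc m) n i = ≡.trans (sumₚ≈sum (suc n) (λ k → narayana (suc k) *ₚ gammaPow m (n ∸ k)) i)
  (≡.trans (K.sum-cong (suc n) {λ k → narayana (suc k) *ₚ gammaPow m (n ∸ k)} {λ k → W.A 1 (suc k) *ₚ W.A m (n ∸ k ℕ.+ m)}
    (λ k _ → *ₚ-cong {narayana (suc k)} {W.A 1 (suc k)} {gammaPow m (n ∸ k)} {W.A m (n ∸ k ℕ.+ m)} (narayana≈A k) (gammaPow≈A m (n ∸ k))) i)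
    (W.A-convolution-shifted m n i))

-- The convention of zero at negative indices is the vanishing of `A m` left of its diagonal.
gammaShift≈A : ∀ m a → gammaShift m a ≈ₚ W.A m a
gammaShift≈A m a with a ℕ.<ᵇ m in eq
... | true  = λ i → ≡.sym (W.A-below (ℕP.<ᵇ⇒< a m (≡.subst Bool.T (≡.sym eq) tt)) i)
... | false = λ i → ≡.trans (gammaPow≈A m (a ∸ m) i) (≡.cong (λ k → W.A m k i) (ℕP.m∸n+n≡m m≤a))
  where
  m≤a : m ≤ a
  m≤a = ℕP.≮⇒≥ λ a<m → ≡.subst Bool.T eq (ℕP.<⇒<ᵇ a<m)

-- Comparison of the two determinants

toℕ-punchIn : ∀ {n} (j : Fin (suc n)) c → toℕ (punchIn j c) ≡ skip (toℕ j) (toℕ c)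
toℕ-punchIn F.zero    c         = ≡.refl
toℕ-punchIn (F.suc j) F.zero    = ≡.refl
toℕ-punchIn (F.suc j) (F.suc c) = ≡.cong suc (toℕ-punchIn j c)

sumFinₚ≈sum : ∀ n f g → (∀ i → f i ≈ₚ g (toℕ i)) → sumFinₚ n f ≈ₚ K.sum n g
sumFinₚ≈sum zero    f g f≈g k = ≡.refl
sumFinₚ≈sum (suc n) f g f≈g k = ≡.trans
  (≡.cong₂ ℤ._+_ (f≈g F.zero k) (sumFinₚ≈sum n (λ i → f (F.suc i)) (λ i → g (suc i)) (λ i → f≈g (F.suc i)) k))
  (≡.sym (K.sum-first n g k))

det≈D : ∀ n M ρ → (∀ i j → M i j ≈ₚ ρ (toℕ i) (toℕ j)) → det n M ≈ₚ Det.D n ρ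
det≈D zero    M ρ M≈ρ k = ≡.sym (Det.D-empty ρ k)
det≈D (suc n) M ρ M≈ρ k = ≡.trans
  (sumFinₚ≈sum (suc n) term (λ j → K.sgn j *ₚ ρ 0 j *ₚ Det.D n (Det.minor j ρ)) term≈ k)
  (≡.sym (Det.D-expand n ρ k))
  where
  term : Fin (suc n) → Poly
  term j = const (sign (toℕ j)) *ₚ M F.zero j *ₚ det n (λ r c → M (F.suc r) (punchIn j c))
  term≈ : ∀ j → term j ≈ₚ K.sgn (toℕ j) *ₚ ρ 0 (toℕ j) *ₚ Det.D n (Det.minor (toℕ j) ρ)
  term≈ j = *ₚ-cong {const (sign (toℕ j)) *ₚ M F.zero j} {K.sgn (toℕ j) *ₚ ρ 0 (toℕ j)}
    {det n (λ r c → M (F.suc r) (punchIn j c))} {Det.D n (Det.minor (toℕ j) ρ)}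
    (*ₚ-cong {const (sign (toℕ j))} {K.sgn (toℕ j)} {M F.zero j} {ρ 0 (toℕ j)} (sign≈sgn (toℕ j)) (M≈ρ F.zero j))
    (det≈D n _ (Det.minor (toℕ j) ρ) λ r c k →
      ≡.trans (M≈ρ (F.suc r) (punchIn j c) k) (≡.cong (λ l → ρ (suc (toℕ r)) l k) (toℕ-punchIn j c)))

-- Signs and exponents

triangle-double : ∀ n → n ℕ.* (n ∸ 1) ≡ triangle n ℕ.* 2
triangle-double zero          = ≡.refl
triangle-double (suc zero)    = ≡.refl
triangle-double (suc (suc n)) = begin
  suc (suc n) ℕ.* suc n                       ≡⟨ split n ⟩
  suc n ℕ.* n ℕ.+ suc n ℕ.* 2                 ≡⟨ ≡.cong (ℕ._+ suc n ℕ.* 2) (triangle-double (suc n)) ⟩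
  triangle (suc n) ℕ.* 2 ℕ.+ suc n ℕ.* 2      ≡⟨ collect (suc n) (triangle (suc n)) ⟩
  (suc n ℕ.+ triangle (suc n)) ℕ.* 2          ∎
  where
  open ≡.≡-Reasoning
  split : ∀ n → suc (suc n) ℕ.* suc n ≡ suc n ℕ.* n ℕ.+ suc n ℕ.* 2
  split = solve-∀
  collect : ∀ x y → y ℕ.* 2 ℕ.+ x ℕ.* 2 ≡ (x ℕ.+ y) ℕ.* 2
  collect = solve-∀

halve : ∀ {x} y → x ≡ y ℕ.* 2 → x ℕD./ 2 ≡ y
halve y ≡.refl = ℕD.m*n/n≡m y 2

xi-triangle : ∀ m n → xi m n ≡ sign (n ℕ.* triangle m)
xi-triangle m n = ≡.cong sign (halve (n ℕ.* triangle m) (begin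
  n ℕ.* m ℕ.* (m ∸ 1)       ≡⟨ ℕP.*-assoc n m (m ∸ 1) ⟩
  n ℕ.* (m ℕ.* (m ∸ 1))     ≡⟨ ≡.cong (n ℕ.*_) (triangle-double m) ⟩
  n ℕ.* (triangle m ℕ.* 2)  ≡⟨ ℕP.*-assoc n (triangle m) 2 ⟨
  n ℕ.* triangle m ℕ.* 2    ∎))
  where open ≡.≡-Reasoning

exponent-multiple : ∀ s n → (suc s ℕ.* n ℕ.* (suc s ℕ.* suc n ∸ 2)) ℕD./ 2 ≡ suc s ℕ.* suc s ℕ.* triangle n ℕ.+ n ℕ.* suc s ℕ.* s
-- For m = 1 the truncated difference m - 2 differs from the true one; it is multiplied by n = 0
-- here. For positive n the subtraction computes.
exponent-multiple s zero    = halve _ (vanish s (suc s ℕ.* 1 ∸ 2))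
  where
  vanish : ∀ s x → suc s ℕ.* 0 ℕ.* x ≡ (suc s ℕ.* suc s ℕ.* 0 ℕ.+ 0 ℕ.* suc s ℕ.* s) ℕ.* 2
  vanish = solve-∀
exponent-multiple s (suc n) = halve _ (begin
  suc s ℕ.* suc n ℕ.* (n ℕ.+ s ℕ.* suc (suc n))
    ≡⟨ split s n ⟩
  suc s ℕ.* suc s ℕ.* (suc n ℕ.* n) ℕ.+ suc n ℕ.* suc s ℕ.* s ℕ.* 2
    ≡⟨ ≡.cong (λ x → suc s ℕ.* suc s ℕ.* x ℕ.+ suc n ℕ.* suc s ℕ.* s ℕ.* 2) (triangle-double (suc n)) ⟩
  suc s ℕ.* suc s ℕ.* (triangle (suc n) ℕ.* 2) ℕ.+ suc n ℕ.* suc s ℕ.* s ℕ.* 2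
    ≡⟨ collect s n (triangle (suc n)) ⟩
  (suc s ℕ.* suc s ℕ.* triangle (suc n) ℕ.+ suc n ℕ.* suc s ℕ.* s) ℕ.* 2 ∎)
  where
  open ≡.≡-Reasoning
  split : ∀ s n → suc s ℕ.* suc n ℕ.* (n ℕ.+ s ℕ.* suc (suc n)) ≡
    suc s ℕ.* suc s ℕ.* (suc n ℕ.* n) ℕ.+ suc n ℕ.* suc s ℕ.* s ℕ.* 2
  split = solve-∀
  collect : ∀ s n x → suc s ℕ.* suc s ℕ.* (x ℕ.* 2) ℕ.+ suc n ℕ.* suc s ℕ.* s ℕ.* 2 ≡
    (suc s ℕ.* suc s ℕ.* x ℕ.+ suc n ℕ.* suc s ℕ.* s) ℕ.* 2
  collect = solve-∀

exponent-multiple+1 : ∀ m n → (m ℕ.* m ℕ.* n ℕ.* (n ∸ 1)) ℕD./ 2 ≡ m ℕ.* m ℕ.* triangle n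
exponent-multiple+1 m n = halve (m ℕ.* m ℕ.* triangle n) (begin
  m ℕ.* m ℕ.* n ℕ.* (n ∸ 1)         ≡⟨ ℕP.*-assoc (m ℕ.* m) n (n ∸ 1) ⟩
  m ℕ.* m ℕ.* (n ℕ.* (n ∸ 1))       ≡⟨ ≡.cong (m ℕ.* m ℕ.*_) (triangle-double n) ⟩
  m ℕ.* m ℕ.* (triangle n ℕ.* 2)    ≡⟨ ℕP.*-assoc (m ℕ.* m) (triangle n) 2 ⟨
  m ℕ.* m ℕ.* triangle n ℕ.* 2      ∎)
  where open ≡.≡-Reasoning

sign-+ : ∀ a b → sign (a ℕ.+ b) ≡ sign a ℤ.* sign b
sign-+ zero    b = ≡.sym (ℤP.*-identityˡ (sign b))
sign-+ (suc a) b = ≡.trans (≡.cong ℤ.-_ (sign-+ a b)) (ℤP.neg-distribˡ-* (sign a) (sign b))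

-- The cases of the evaluation

module _ (m′ : ℕ) where

  private
    m = suc m′
    module H = W.Reduction m

  Delta≈D : ∀ N → Delta m N ≈ₚ Det.D N H.H
  Delta≈D N = det≈D N _ H.H λ i j → gammaShift≈A m (toℕ i ℕ.+ toℕ j)

  monomial≈ : ∀ w e n {c} → c ≡ sign w → ∀ {e′} → e′ ≡ e →
    K.sgn w *ₚ tₚ K.^ e *ₚ H.Q n ≈ₚ const c *ₚ tpow e′ *ₚ qint n m
  monomial≈ w e n ≡.refl ≡.refl = *ₚ-cong {K.sgn w *ₚ tₚ K.^ e} {const (sign w) *ₚ tpow e} {H.Q n} {qint n m}
    (*ₚ-cong {K.sgn w} {const (sign w)} {tₚ K.^ e} {tpow e} (λ k → ≡.sym (sign≈sgn w k)) (λ k → ≡.sym (tpow≈^ e k)))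
    (λ k → ≡.sym (≡.trans (sumₚ≈sum n (λ j → tpow (m ℕ.* j)) k)
      (K.sum-cong n {λ j → tpow (m ℕ.* j)} {λ j → tₚ K.^ (m ℕ.* j)} (λ j _ → tpow≈^ (m ℕ.* j)) k)))

  Delta-multiple : ∀ n → Delta m (m ℕ.* suc n) ≈ₚ
    const (ℤ.- xi m (suc n)) *ₚ tpow ((m ℕ.* n ℕ.* (m ℕ.* suc n ∸ 2)) ℕD./ 2) *ₚ qint n m
  Delta-multiple n k = ≡.trans (≡.cong (λ N → Delta m N k) size) (≡.trans (Delta≈D _ k)
    (≡.trans (H.D-H-nonzero n m′ ℕP.≤-refl (λ b x eq → ≡.cong suc (≡.trans (ℕP.+-suc b x) eq)) k)
      (monomial≈ (m ℕ.+ (n ℕ.* triangle m ℕ.+ triangle m′)) _ n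
        -- Since `triangle m` is m′ + `triangle m′`, the accumulated sign index exceeds (n+1)
        -- `triangle m` by exactly one; this is the minus sign in front of ξ.
        (≡.cong ℤ.-_ (≡.trans (xi-triangle m (suc n)) (≡.cong sign (rearrange m′ (triangle m′) (n ℕ.* triangle m)))))
        (exponent-multiple m′ n) k)))
    where
    size : m ℕ.* suc n ≡ suc (n ℕ.* m ℕ.+ m′)
    size = lemma m′ n
      where
      lemma : ∀ m n → suc m ℕ.* suc n ≡ suc (n ℕ.* suc m ℕ.+ m)
      lemma = solve-∀
    rearrange : ∀ a b c → a ℕ.+ b ℕ.+ c ≡ a ℕ.+ (c ℕ.+ b)
    rearrange = solve-∀

  Delta-multiple+1 : ∀ n → Delta m (m ℕ.* n ℕ.+ 1) ≈ₚ
    const (sign m ℤ.* xi m n) *ₚ tpow ((m ℕ.* m ℕ.* n ℕ.* (n ∸ 1)) ℕD./ 2) *ₚ qint n m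
  Delta-multiple+1 n k = ≡.trans (≡.cong (λ N → Delta m N k) size) (≡.trans (Delta≈D _ k)
    (≡.trans (H.D-H-nonzero n 0 (s≤s z≤n) (λ b x ()) k)
      (monomial≈ (m ℕ.+ (n ℕ.* triangle m ℕ.+ 0)) _ n
        (≡.trans (≡.cong (λ x → sign m ℤ.* x) (≡.trans (xi-triangle m n) (≡.cong sign (≡.sym (ℕP.+-identityʳ (n ℕ.* triangle m))))))
          (≡.sym (sign-+ m (n ℕ.* triangle m ℕ.+ 0))))
        (≡.trans (exponent-multiple+1 m n) (lemma m n (triangle n))) k)))
    where
    lemma : ∀ m n x → m ℕ.* m ℕ.* x ≡ m ℕ.* m ℕ.* x ℕ.+ n ℕ.* m ℕ.* 0
    lemma = solve-∀
    size : m ℕ.* n ℕ.+ 1 ≡ suc (n ℕ.* m ℕ.+ 0)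
    size = lemma′ m n
      where
      lemma′ : ∀ m n → m ℕ.* n ℕ.+ 1 ≡ suc (n ℕ.* m ℕ.+ 0)
      lemma′ = solve-∀

  Delta-other : ∀ N → (∀ n → N ≢ m ℕ.* n) → (∀ n → N ≢ m ℕ.* n ℕ.+ 1) → Delta m N ≈ₚ 0ₚ
  Delta-other N ≢mn ≢mn+1 with H.decompose N
  ... | n , zero , _ , ≡.refl = ⊥-elim (≢mn n (≡.trans (ℕP.+-identityʳ (n ℕ.* m)) (ℕP.*-comm n m)))
  ... | n , suc zero , _ , ≡.refl = ⊥-elim (≢mn+1 n (≡.cong (ℕ._+ 1) (ℕP.*-comm n m)))
  ... | n , suc (suc s) , s<m , ≡.refl = λ k → ≡.trans (≡.cong (λ N → Delta m N k) (ℕP.+-suc (n ℕ.* m) (suc s)))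
    (≡.trans (Delta≈D _ k) (H.D-H-zero n s s<m k))

open import Data.Nat using (_+_; _*_; _/_)
open import Data.Integer using (-_)

theorem1p4 : (m N : ℕ) → m ≥ 1 →
    (N ≡ 0 → Delta m N ≈ₚ 1ₚ)
    × (∀ n → n ≥ 1 → N ≡ m * n →
    Delta m N ≈ₚ const (- xi m n) *ₚ tpow ((m * (n ∸ 1) * (m * n ∸ 2)) / 2) *ₚ qint (n ∸ 1) m)
    × (∀ n → N ≡ m * n + 1 →
    Delta m N ≈ₚ const (sign m Data.Integer.* xi m n) *ₚ tpow ((m * m * n * (n ∸ 1)) / 2) *ₚ qint n m)
    × (N ≢ 0 → (∀ n → N ≢ m * n) → (∀ n → N ≢ m * n + 1) → Delta m N ≈ₚ 0ₚ)
theorem1p4 (suc m) N _ =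
  (λ { ≡.refl _ → ≡.refl }) ,
  (λ { (suc n) _ ≡.refl → Delta-multiple m n }) ,
  (λ { n ≡.refl → Delta-multiple+1 m n }) ,
  (λ _ → Delta-other m N)
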